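{- Let $\mathcal A$ be a gargantuan (unweighted) species of structures that can be represented as $\mathcal A=\mathcal E\circ\mathcal B$ for some species of structures $\mathcal B$, where $\mathcal E$ is the species of sets. Assume that $n$ is a positive integer and $s\in\mathcal A$ is a random $\mathcal A$-structure on $[n]$. In this case, $$\mathbb P(s\text{ is connected})\approx 1-\sum_{k\ge1}\mathfrak d_k\cdot\binom nk\cdot\frac{\mathfrak a_{n-k}}{\mathfrak a_n},$$ where $\mathfrak a_n$ is the counting sequence of $\mathcal A$, $$\mathfrak d_k=\#\{s'\in\mathcal A_k\mid\pi_0(s')\text{ is odd}\}-\#\{s'\in\mathcal A_k\mid\pi_0(s')\text{ is even}\},$$ and $\pi_0(s')$ is the number of connected components of the structure $s'$.
   Context: A species of structures $F$ assigns to each finite set $U$ a finite set $F[U]$ of structures and to each bijection $\sigma:U\to V$ a map $F[\sigma]:F[U]\to F[V]$, functorially ($F[\tau\circ\sigma]=F[\tau]\circ F[\sigma]$, $F[\mathrm{Id}_U]=\mathrm{Id}_{F[U]}$). Write $[n]=\{1,\dots,n\}$, $[0]=\emptyset$. The counting sequence of $\mathcal A$ is $\mathfrak a_n=|\mathcal A[[n]]|$, and $s'\in\mathcal A_k$ means that $s'$ is an $\mathcal A$-structure on $[k]$. Equality of species means natural isomorphism. A random $\mathcal A$-structure on $[n]$ is taken uniformly from $\mathcal A[[n]]$, and $\mathbb P(\cdot)$ denotes the resulting sequence of probabilities indexed by those $n$ with $\mathfrak a_n>0$. $\mathcal E$ is the species of sets ($\mathcal E[U]=\{U\}$). For $\mathcal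 B$ with $\mathcal B[\emptyset]=\emptyset$, an $(\mathcal E\circ\mathcal B)$-structure on $U$ is a partition of $U$ together with a $\mathcal B$-structure on each block; these $\mathcal B$-structures are its connected components, $\pi_0$ is their number, and the structure is connected if it is a single $\mathcal B$-structure ($\pi_0=1$). A sequence $(a_n)$ is gargantuan if (i) $a_{n-1}/a_n\to0$ as $n\to\infty$ and (ii) for each $r\in\mathbb Z_{\ge0}$, $\sum_{k=r}^{n-r}|a_ka_{n-k}|=O(a_{n-r})$. The species $\mathcal A$ is gargantuan if the sequence $a_n=\mathfrak a_n/n!$ is gargantuan; in particular it is assumed that $a_n\neq0$ for almost all $n\in\mathbb Z_{\ge0}$. Notation $\approx$: for a sequence $(x_n)$ and an integer $\ell$, $x_n\approx\sum_{k\ge \ell}f_k(n)$ means that for every integer $r\ge \ell$, $x_n=\sum_{k=\ell}^{r}f_k(n)+O\big(f_{r+1}(n)\big)$, and for every integer $k\ge \ell$, $f_{k+1}(n)=o\big(f_k(n)\big)$, as $n\to\infty$. Here $\ell=0$, $f_0(n)=1$ and $f_k(n)=-\mathfrak d_k\binom nk\frac{\mathfrak a_{n-k}}{\mathfrak a_n}$ for $k\ge1$.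
   Formalization: The literal ≈ fails when some 𝔡_k=0 (simple graphs: 𝔡_2=0, 𝔡_3=2); proved: errors O(C(n,r+1)𝔞_{n-r-1}/𝔞_n), with C(n,k+1)𝔞_{n-k-1}/𝔞_n = o(C(n,k)𝔞_{n-k}/𝔞_n), in all cases, and the literal ≈ whenever 𝔡_k≠0 for all k≥1. -}

module Defs where

open import Level using (0ℓ)
open import Data.Nat as ℕ using (ℕ; zero; suc; _∸_; _!)
open import Data.Nat.Combinatorics using (_C_)
open import Data.Nat.Divisibility using (_∣_; _∣?_)
open import Data.Integer as ℤ using (ℤ; +_)
open import Data.Rational as ℚ using (ℚ; 0ℚ; 1ℚ)
open import Data.Fin using (Fin; zero; suc)
import Data.Fin.Properties as Fin
open import Axiom.UniquenessOfIdentityProofs using (module Decidable⇒UIP)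
open import Data.List using (length; filter; allFin)
open import Data.Product using (_,_; proj₁; proj₂; ∃-syntax)
open import Data.Unit using (⊤; tt)
open import Function using (_∘_)
open import Function.Bundles using (Inverse; _↔_; mk↔ₛ′)
open import Function.Construct.Identity using (↔-id)
open import Function.Construct.Symmetry using (↔-sym)
open import Function.Construct.Composition using (_↔-∘_)
open import Function.Definitions using (StrictlySurjective)
open import Relation.Nullary using (¬_; Dec; yes; no)
open import Relation.Nullary.Decidable using (¬?)
open import Relation.Nullary.Negation using (contradiction)
open import Relation.Unary using (Pred; Decidable)
open import Relation.Binary.Bundles using (Setoid)
open import Relation.Binary.PropositionalEquality
  using (_≡_; _≢_; refl; sym; trans; cong; setoid)

------------------------------------------------------------------------
-- Finite sets and bijections

record FinSet : Set₁ where
  constructor finSet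
  field
    ∣_∣ˢ : Set
    size : ℕ
    enum : ∣_∣ˢ ↔ Fin size

open FinSet public using (∣_∣ˢ)

[_] : ℕ → FinSet
[ n ] = finSet (Fin n) n (↔-id _)

-- A record, rather than a synonym for _↔_, so that U and V can be inferred.
infix 4 _≅_
record _≅_ (U V : FinSet) : Set where
  constructor bij
  field
    fun : ∣ U ∣ˢ ↔ ∣ V ∣ˢ
  open Inverse fun public
    using (to; from; strictlyInverseˡ; strictlyInverseʳ)

  injective : ∀ {u v} → to u ≡ to v → u ≡ v
  injective {u} {v} eq =
    trans (sym (strictlyInverseʳ u)) (trans (cong from eq) (strictlyInverseʳ v))

open _≅_ public using (to; from)

≅-id : ∀ {U} → U ≅ U
≅-id = bij (↔-id _)

≅-sym : ∀ {U V} → U ≅ V → V ≅ U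
≅-sym (bij σ) = bij (↔-sym σ)

infixr 9 _∘≅_
_∘≅_ : ∀ {U V W} → V ≅ W → U ≅ V → U ≅ W
bij τ ∘≅ bij σ = bij (τ ↔-∘ σ)

------------------------------------------------------------------------
-- Species of structures
--
-- Sets of structures are setoids, because the structures of a composite
-- species involve a set partition, i.e. a quotient.

record Functor : Set₁ where
  field
    obj      : FinSet → Setoid 0ℓ 0ℓ

  Str : FinSet → Set
  Str U = Setoid.Carrier (obj U)

  _≈_ : ∀ {U} → Str U → Str U → Set
  _≈_ {U} = Setoid._≈_ (obj U)

  field
    act      : ∀ {U V} → U ≅ V → Str U → Str V
    act-cong : ∀ {U V} (σ : U ≅ V) {s t : Str U} →
               _≈_ {U} s t → _≈_ {V} (act σ s) (act σ t)
    -- Without function extensionality, pointwise equal bijections have to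
    -- be required to act in the same way.
    act-ext  : ∀ {U V} (σ τ : U ≅ V) → (∀ u → to σ u ≡ to τ u) →
               (s : Str U) → _≈_ {V} (act σ s) (act τ s)
    act-id   : ∀ {U} (s : Str U) → _≈_ {U} (act ≅-id s) s
    act-∘    : ∀ {U V W} (τ : V ≅ W) (σ : U ≅ V) (s : Str U) →
               _≈_ {W} (act (τ ∘≅ σ) s) (act τ (act σ s))

  act-via  : ∀ {U V W} (τ : V ≅ W) (σ : U ≅ V) (ρ : U ≅ W) →
             (∀ u → to τ (to σ u) ≡ to ρ u) →
             (s : Str U) → _≈_ {W} (act τ (act σ s)) (act ρ s)
  act-via {U} {V} {W} τ σ ρ eq s =
    W.trans (W.sym (act-∘ τ σ s)) (act-ext (τ ∘≅ σ) ρ eq s)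
    where module W = Setoid (obj W)

  act-trivial : ∀ {U} (σ : U ≅ U) → (∀ u → to σ u ≡ u) →
                (s : Str U) → _≈_ {U} (act σ s) s
  act-trivial {U} σ eq s = U.trans (act-ext σ ≅-id eq s) (act-id s)
    where module U = Setoid (obj U)

record Finite (S : Setoid 0ℓ 0ℓ) : Set where
  field
    card : ℕ
    enum : Inverse S (setoid (Fin card))

  # : ∀ {P : Pred (Setoid.Carrier S) 0ℓ} → Decidable P → ℕ
  # P? = length (filter (λ i → P? (Inverse.from enum i)) (allFin card))

record Species : Set₁ where
  field
    functor : Functor
  open Functor functor public
  field
    finite  : ∀ U → Finite (obj U)

open Species public using (functor)

infix 4 _≅ˢ_
record _≅ˢ_ (F G : Functor) : Set₁ where
  private
    module F = Functor F
    module G = Functor G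
  field
    iso     : ∀ U → Inverse (F.obj U) (G.obj U)
    natural : ∀ {U V} (σ : U ≅ V) (s : F.Str U) →
              G._≈_ {V} (Inverse.to (iso V) (F.act σ s))
                        (G.act σ (Inverse.to (iso U) s))

ℰ : Species
ℰ = record
  { functor = record
    { obj      = λ _ → setoid ⊤
    ; act      = λ _ s → s
    ; act-cong = λ _ eq → eq
    ; act-ext  = λ _ _ _ _ → refl
    ; act-id   = λ _ → refl
    ; act-∘    = λ _ _ _ → refl
    }
  ; finite = λ _ → record
    { card = 1
    ; enum = mk↔ₛ′ (λ _ → zero) (λ _ → tt) (λ { zero → refl }) (λ _ → refl)
    }
  }

------------------------------------------------------------------------
-- Fibres of maps out of a finite set

Sub : ∀ {A : Set} {k} → (A → Fin k) → Fin k → Set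
Sub p i = ∃[ u ] p u ≡ i

Sub-≡ : ∀ {A : Set} {k} (p : A → Fin k) {i : Fin k}
        {x y : Sub p i} → proj₁ x ≡ proj₁ y → x ≡ y
Sub-≡ p {x = u , e} {y = .u , e′} refl =
  cong (u ,_) (Decidable⇒UIP.≡-irrelevant Fin._≟_ e e′)

enumFin : ∀ n {k} (p : Fin n → Fin k) (i : Fin k) →
          ∃[ m ] (Sub p i ↔ Fin m)
enumFin zero    p i = 0 , mk↔ₛ′ (λ ()) (λ ()) (λ ()) (λ ())
enumFin (suc n) p i with p zero Fin.≟ i | enumFin n (p ∘ suc) i
... | yes p0≡i | m , e = suc m , mk↔ₛ′ f g fg gf
  where
  f : Sub p i → Fin (suc m)
  f (zero  , _) = zero
  f (suc u , q) = suc (Inverse.to e (u , q))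
  g : Fin (suc m) → Sub p i
  g zero    = zero , p0≡i
  g (suc j) = let u , q = Inverse.from e j in suc u , q
  fg : ∀ j → f (g j) ≡ j
  fg zero    = refl
  fg (suc j) = cong suc (Inverse.strictlyInverseˡ e j)
  gf : ∀ x → g (f x) ≡ x
  gf (zero  , q) = Sub-≡ p refl
  gf (suc u , q) =
    Sub-≡ p (cong (suc ∘ proj₁) (Inverse.strictlyInverseʳ e (u , q)))
... | no p0≢i  | m , e = m , mk↔ₛ′ f g fg gf
  where
  f : Sub p i → Fin m
  f (zero  , q) = contradiction q p0≢i
  f (suc u , q) = Inverse.to e (u , q)
  g : Fin m → Sub p i
  g j = let u , q = Inverse.from e j in suc u , q
  fg : ∀ j → f (g j) ≡ j
  fg j = Inverse.strictlyInverseˡ e j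
  gf : ∀ x → g (f x) ≡ x
  gf (zero  , q) = contradiction q p0≢i
  gf (suc u , q) =
    Sub-≡ p (cong (suc ∘ proj₁) (Inverse.strictlyInverseʳ e (u , q)))

-- Opaque so that the unifier does not unfold the enumerations.
opaque
  sub-finite : (U : FinSet) {k : ℕ} (p : ∣ U ∣ˢ → Fin k) (i : Fin k) →
               ∃[ m ] (Sub p i ↔ Fin m)
  sub-finite (finSet A n e) {k} p i =
    proj₁ (enumFin n p′ i) , (proj₂ (enumFin n p′ i) ↔-∘ reindex)
    where
    p′ : Fin n → Fin k
    p′ = p ∘ Inverse.from e
    reindex : Sub p i ↔ Sub p′ i
    reindex = mk↔ₛ′
      (λ (u , q) → Inverse.to e u ,
                   trans (cong p (Inverse.strictlyInverseʳ e u)) q)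
      (λ (j , q) → Inverse.from e j , q)
      (λ (j , _) → Sub-≡ p′ (Inverse.strictlyInverseˡ e j))
      (λ (u , _) → Sub-≡ p (Inverse.strictlyInverseʳ e u))

fibre : (U : FinSet) {k : ℕ} → (∣ U ∣ˢ → Fin k) → Fin k → FinSet
fibre U p i =
  finSet (Sub p i) (proj₁ (sub-finite U p i)) (proj₂ (sub-finite U p i))

fibre≅ : ∀ {U V k l} {p : ∣ U ∣ˢ → Fin k} {q : ∣ V ∣ˢ → Fin l}
         (σ : U ≅ V) (φ : [ k ] ≅ [ l ]) →
         (∀ u → q (to σ u) ≡ to φ (p u)) →
         ∀ {i j} → to φ i ≡ j → fibre U p i ≅ fibre V q j
fibre≅ {p = p} {q} σ φ sq {i} φi≡j = bij (mk↔ₛ′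
  (λ (u , e) → to σ u , trans (sq u) (trans (cong (to φ) e) φi≡j))
  (λ (v , e) → from σ v , _≅_.injective φ
     (trans (sym (sq (from σ v)))
       (trans (cong q (_≅_.strictlyInverseˡ σ v)) (trans e (sym φi≡j)))))
  (λ (v , _) → Sub-≡ q (_≅_.strictlyInverseˡ σ v))
  (λ (u , _) → Sub-≡ p (_≅_.strictlyInverseʳ σ u)))

------------------------------------------------------------------------
-- Partitional composition

module _ (F G : Functor) where
  private
    module F = Functor F
    module G = Functor G

  -- A set partition of U into k (nonempty) blocks is a surjection from U onto
  -- Fin k; two such surjections are the same partition when they differ by a
  -- relabelling of the blocks, see _≋_.
  record ∘-Str (U : FinSet) : Set where
    field
      blocks  : ℕ
      block   : ∣ U ∣ˢ → Fin blocks
      onto    : StrictlySurjective _≡_ block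
      outer   : F.Str [ blocks ]
      inner   : ∀ i → G.Str (fibre U block i)

  open ∘-Str

  record _≋_ {U : FinSet} (x y : ∘-Str U) : Set where
    field
      relabel : [ blocks x ] ≅ [ blocks y ]
      block-≡ : ∀ u → block y u ≡ to relabel (block x u)
      outer-≈ : F._≈_ {[ blocks y ]} (F.act relabel (outer x)) (outer y)
      inner-≈ : ∀ i → G._≈_ {fibre U (block y) (to relabel i)}
                  (G.act (fibre≅ ≅-id relabel block-≡ refl) (inner x i))
                  (inner y (to relabel i))

  open _≋_

  inner-≈′ : ∀ {U} {x y : ∘-Str U} (r : x ≋ y) {i j}
             (e : to (relabel r) i ≡ j) →
             G._≈_ {fibre U (block y) j}
               (G.act (fibre≅ ≅-id (relabel r) (block-≡ r) e) (inner x i))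
               (inner y j)
  inner-≈′ r refl = inner-≈ r _

  ≋-refl : ∀ {U} {x : ∘-Str U} → x ≋ x
  ≋-refl {x = x} = record
    { relabel = ≅-id
    ; block-≡ = λ _ → refl
    ; outer-≈ = F.act-id _
    ; inner-≈ = λ i → G.act-trivial _ (λ _ → Sub-≡ (block x) refl) _
    }

  ≋-sym : ∀ {U} {x y : ∘-Str U} → x ≋ y → y ≋ x
  ≋-sym {U} {x} {y} r = record
    { relabel = φ⁻¹
    ; block-≡ = sq
    ; outer-≈ = Fx.trans (F.act-cong φ⁻¹ (Setoid.sym (F.obj [ blocks y ]) (outer-≈ r)))
                (Fx.trans (F.act-via φ⁻¹ φ ≅-id (_≅_.strictlyInverseʳ φ) _)
                          (F.act-id _))
    ; inner-≈ = λ j →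
        let module X = Setoid (G.obj (fibre U (block x) (from φ j)))
            module Y = Setoid (G.obj (fibre U (block y) j))
            back = fibre≅ ≅-id φ⁻¹ sq refl
            forth = fibre≅ ≅-id φ (block-≡ r) (_≅_.strictlyInverseˡ φ j)
        in X.trans
             (G.act-cong back
               (Y.sym (inner-≈′ r (_≅_.strictlyInverseˡ φ j))))
             (X.trans
               (G.act-via back forth ≅-id (λ _ → Sub-≡ (block x) refl) _)
               (G.act-id _))
    }
    where
    φ = relabel r
    φ⁻¹ = ≅-sym φ
    sq : ∀ u → block x u ≡ from φ (block y u)
    sq u = trans (sym (_≅_.strictlyInverseʳ φ _))
                 (cong (from φ) (sym (block-≡ r u)))
    module Fx = Setoid (F.obj [ blocks x ])

  ≋-trans : ∀ {U} {x y z : ∘-Str U} → x ≋ y → y ≋ z → x ≋ z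
  ≋-trans {U} {x} {y} {z} r s = record
    { relabel = relabel s ∘≅ relabel r
    ; block-≡ = sq
    ; outer-≈ = Fz.trans (F.act-∘ (relabel s) (relabel r) _)
                (Fz.trans (F.act-cong (relabel s) (outer-≈ r)) (outer-≈ s))
    ; inner-≈ = λ i →
        let j = to (relabel r) i
            module Z = Setoid (G.obj (fibre U (block z) (to (relabel s) j)))
            f = fibre≅ ≅-id (relabel r) (block-≡ r) refl
            g = fibre≅ ≅-id (relabel s) (block-≡ s) refl
        in Z.trans
             (Z.sym (G.act-via g f
               (fibre≅ ≅-id (relabel s ∘≅ relabel r) sq refl)
               (λ _ → Sub-≡ (block z) refl) _))
             (Z.trans (G.act-cong g (inner-≈ r i)) (inner-≈ s j))
    }
    where
    sq : ∀ u → block z u ≡ to (relabel s) (to (relabel r) (block x u))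
    sq u = trans (block-≡ s u) (cong (to (relabel s)) (block-≡ r u))
    module Fz = Setoid (F.obj [ blocks z ])

  push : ∀ {U V} (σ : U ≅ V) (x : ∘-Str U) (i : Fin (blocks x)) →
         fibre U (block x) i ≅ fibre V (block x ∘ from σ) i
  push σ x i =
    fibre≅ σ ≅-id (λ u → cong (block x) (_≅_.strictlyInverseʳ σ u)) refl

  ∘-act : ∀ {U V} → U ≅ V → ∘-Str U → ∘-Str V
  ∘-act σ x = record
    { blocks = blocks x
    ; block  = block x ∘ from σ
    ; onto   = λ i → let u , e = onto x i in
                 to σ u , trans (cong (block x) (_≅_.strictlyInverseʳ σ u)) e
    ; outer  = outer x
    ; inner  = λ i → G.act (push σ x i) (inner x i)
    }

  ∘-act-cong : ∀ {U V} (σ : U ≅ V) {x y : ∘-Str U} →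
               x ≋ y → ∘-act σ x ≋ ∘-act σ y
  ∘-act-cong {U} {V} σ {x} {y} r = record
    { relabel = relabel r
    ; block-≡ = λ v → block-≡ r (from σ v)
    ; outer-≈ = outer-≈ r
    ; inner-≈ = λ i →
        let j = to (relabel r) i
            module Y = Setoid (G.obj (fibre V (block y ∘ from σ) j))
            f = fibre≅ ≅-id (relabel r) (block-≡ r) refl
            f′ = fibre≅ ≅-id (relabel r) (λ v → block-≡ r (from σ v)) refl
        in Y.trans (G.act-via f′ (push σ x i) (push σ y j ∘≅ f)
                     (λ _ → Sub-≡ (block y ∘ from σ) refl) _)
           (Y.trans (G.act-∘ (push σ y j) f _)
                    (G.act-cong (push σ y j) (inner-≈ r i)))
    }

  ∘-act-ext : ∀ {U V} (σ τ : U ≅ V) → (∀ u → to σ u ≡ to τ u) →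
              (x : ∘-Str U) → ∘-act σ x ≋ ∘-act τ x
  ∘-act-ext σ τ eq x = record
    { relabel = ≅-id
    ; block-≡ = λ v → cong (block x) (sym (from-≡ v))
    ; outer-≈ = F.act-id _
    ; inner-≈ = λ i → G.act-via _ _ _
        (λ (u , _) → Sub-≡ (block x ∘ from τ) (eq u)) _
    }
    where
    from-≡ : ∀ v → from σ v ≡ from τ v
    from-≡ v = _≅_.injective τ
      (trans (sym (eq (from σ v)))
        (trans (_≅_.strictlyInverseˡ σ v) (sym (_≅_.strictlyInverseˡ τ v))))

  ∘-act-id : ∀ {U} (x : ∘-Str U) → ∘-act ≅-id x ≋ x
  ∘-act-id {U} x = record
    { relabel = ≅-id
    ; block-≡ = λ _ → refl
    ; outer-≈ = F.act-id _
    ; inner-≈ = λ i →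
        let module X = Setoid (G.obj (fibre U (block x) i)) in
        X.trans (G.act-via _ _ ≅-id (λ _ → Sub-≡ (block x) refl) _)
                (G.act-id _)
    }

  ∘-act-∘ : ∀ {U V W} (τ : V ≅ W) (σ : U ≅ V) (x : ∘-Str U) →
            ∘-act (τ ∘≅ σ) x ≋ ∘-act τ (∘-act σ x)
  ∘-act-∘ {W = W} τ σ x = record
    { relabel = ≅-id
    ; block-≡ = λ _ → refl
    ; outer-≈ = F.act-id _
    ; inner-≈ = λ i →
        let q = block x ∘ from σ ∘ from τ
            module X = Setoid (G.obj (fibre W q i))
            f = fibre≅ ≅-id ≅-id (λ _ → refl) refl
        in X.trans (G.act-via f (push (τ ∘≅ σ) x i)
                     (push τ (∘-act σ x) i ∘≅ push σ x i)
                     (λ _ → Sub-≡ q refl) (inner x i))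
                   (G.act-∘ (push τ (∘-act σ x) i) (push σ x i) (inner x i))
    }

  -- Finiteness of F ∘ G is not recorded: it holds when F and G are finite, and
  -- below F ∘ G is isomorphic to a species.
  infixr 9 _∘ˢ_
  _∘ˢ_ : Functor
  _∘ˢ_ = record
    { obj = λ U → record
      { Carrier = ∘-Str U
      ; _≈_ = _≋_
      ; isEquivalence = record { refl = ≋-refl ; sym = ≋-sym ; trans = ≋-trans }
      }
    ; act      = ∘-act
    ; act-cong = ∘-act-cong
    ; act-ext  = ∘-act-ext
    ; act-id   = ∘-act-id
    ; act-∘    = ∘-act-∘
    }

------------------------------------------------------------------------
-- Rational sequences and asymptotics

Seq : Set
Seq = ℕ → ℚ

-- Total division, with the junk value 0 for a zero denominator.
infixl 7 _÷₀_
_÷₀_ : ℚ → ℚ → ℚ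
p ÷₀ q with q ℚ.≟ 0ℚ
... | yes _  = 0ℚ
... | no q≢0 = ℚ._÷_ p q ⦃ ℚ.≢-nonZero q≢0 ⦄

fromℤ : ℤ → ℚ
fromℤ z = z ℚ./ 1

fromℕ : ℕ → ℚ
fromℕ n = fromℤ (+ n)

∑< : ℕ → Seq → ℚ
∑< zero    f = 0ℚ
∑< (suc n) f = ∑< n f ℚ.+ f n

∑[_⋯_] : ℕ → ℕ → Seq → ℚ
∑[ lo ⋯ hi ] f = ∑< (suc hi ∸ lo) (λ i → f (lo ℕ.+ i))

Eventually : (ℕ → Set) → Set
Eventually P = ∃[ N ] (∀ n → N ℕ.≤ n → P n)

infix 4 _=O_ _=o_

_⟶0 : Seq → Set
x ⟶0 = ∀ ε → 0ℚ ℚ.< ε → Eventually λ n → ℚ.∣ x n ∣ ℚ.< ε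

_=O_ : Seq → Seq → Set
x =O y = ∃[ C ] Eventually λ n → ℚ.∣ x n ∣ ℚ.≤ C ℚ.* ℚ.∣ y n ∣

_=o_ : Seq → Seq → Set
x =o y = ∀ ε → 0ℚ ℚ.< ε → Eventually λ n → ℚ.∣ x n ∣ ℚ.≤ ε ℚ.* ℚ.∣ y n ∣

record GargantuanSeq (a : Seq) : Set where
  field
    nonzero  : Eventually λ n → a n ≢ 0ℚ
    ratio    : (λ n → a (n ∸ 1) ÷₀ a n) ⟶0
    products : ∀ r → (λ n → ∑[ r ⋯ n ∸ r ] λ k → ℚ.∣ a k ℚ.* a (n ∸ k) ∣)
                     =O (λ n → a (n ∸ r))

-- x(n) ≈ ∑_{k ≥ 0} f k n, with errors measured along the scale g.  For g = f
-- this is the usual x ≈ ∑ f.  A separate scale is needed when some f k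
-- vanish: O(f (k + 1)) would then force an exact equality, and
-- f (k + 1) = o(f k) would force all later terms to vanish.
record Expansion (x : Seq) (f g : ℕ → Seq) : Set where
  field
    remainder : ∀ r → (λ n → x n ℚ.- ∑[ 0 ⋯ r ] λ k → f k n) =O g (suc r)
    scale     : ∀ k → g (suc k) =o g k

_≈∑_ : Seq → (ℕ → Seq) → Set
x ≈∑ f = Expansion x f f

------------------------------------------------------------------------
-- Counting

module Counting (A : Species) where
  open Species A

  𝔞 : ℕ → ℕ
  𝔞 n = Finite.card (finite [ n ])

  Gargantuan : Set
  Gargantuan = GargantuanSeq (λ n → fromℕ (𝔞 n) ÷₀ fromℕ (n !))

  ℙ : (P : ∀ {n} → Pred (Str [ n ]) 0ℓ) → (∀ {n} → Decidable (P {n})) → Seq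
  ℙ P P? n = fromℕ (Finite.# (finite [ n ]) (P? {n})) ÷₀ fromℕ (𝔞 n)

module Components (A B : Species) (A≅ℰ∘B : functor A ≅ˢ functor ℰ ∘ˢ functor B)
  where
  open Species A
  open Counting A

  π₀ : ∀ {U} → Str U → ℕ
  π₀ {U} s = ∘-Str.blocks (Inverse.to (_≅ˢ_.iso A≅ℰ∘B U) s)

  Connected Even Odd : ∀ {n} → Pred (Str [ n ]) 0ℓ
  Connected {n} s = π₀ {[ n ]} s ≡ 1
  Even      {n} s = 2 ∣ π₀ {[ n ]} s
  Odd       {n} s = ¬ Even {n} s

  connected? : ∀ {n} → Decidable (Connected {n})
  connected? {n} s = π₀ {[ n ]} s ℕ.≟ 1

  even? : ∀ {n} → Decidable (Even {n})
  even? {n} s = 2 ∣? π₀ {[ n ]} s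

  odd? : ∀ {n} → Decidable (Odd {n})
  odd? {n} s = ¬? (even? {n} s)

  𝔡 : ℕ → ℤ
  𝔡 k = + # (odd? {k}) ℤ.- + # (even? {k})
    where open Finite (finite [ k ]) using (#)

  ℙ-connected : Seq
  ℙ-connected = ℙ (λ {n} → Connected {n}) (λ {n} → connected? {n})

  scale : ℕ → Seq
  scale zero        n = 1ℚ
  scale k@(suc _)   n = fromℕ (n C k) ℚ.* (fromℕ (𝔞 (n ∸ k)) ÷₀ fromℕ (𝔞 n))

  term : ℕ → Seq
  term zero      n = 1ℚ
  term k@(suc _) n =
    ℚ.- (fromℤ (𝔡 k) ℚ.* fromℕ (n C k) ℚ.* (fromℕ (𝔞 (n ∸ k)) ÷₀ fromℕ (𝔞 n)))

{-# OPTIONS --safe #-}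

-- Let a, b and e be the exponential generating sequences of all structures, of the connected
-- ones, and of - 𝔡.  Splitting off the component of a fixed element gives A′ = B′ A and
-- E′ = - B′ E, hence E A = 1.  Put D r n = a n - ∑_{i ≤ r} a i * b (n - i).  Comparing
-- coefficients in A′ = B′ A and expanding the terms in which b has a small index gives
--   n * D r n = ∑_{r < k < n - r} k * b k * a (n - k) + ∑_{1 ≤ j ≤ r} j * b j * D (r - j) (n - j),
-- so D r n = O(a (n - r - 1)) by strong induction on r.  Finally E A = 1 turns this into
--   b n - ∑_{k ≤ r} e k * a (n - k) = - ∑_{k ≤ r} e k * D (r - k) (n - k) = O(a (n - r - 1)),
-- which is the claim after division by a n.

module Submission where

open import Defs
open import Level using (0ℓ)
open import Data.Bool using (true; false; if_then_else_)
open import Data.Nat as ℕ using (ℕ; zero; suc; _∸_; _≤_; z≤n; s≤s; _!)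
import Data.Nat.Properties as ℕ
import Data.Nat.DivMod as ℕ
open import Data.Nat.Combinatorics
  using (_C_; nCk+nC[k+1]≡[n+1]C[k+1]; nCn≡1; k>n⇒nCk≡0; nCk≡n!/k![n-k]!; k![n∸k]!∣n!)
open import Data.Nat.Divisibility
  using (_∣_; _∣?_; _∣0; ∣-refl; ∣m+n∣m⇒∣n; ∣m∣n⇒∣m+n; ∣1⇒≡1)
open import Data.Nat.Induction using (<-rec)
open import Data.Integer as ℤ using (0ℤ)
import Data.Integer.Properties as ℤ
open import Data.Rational as ℚ using (ℚ; 0ℚ; 1ℚ; _+_; _*_; -_; _-_; ∣_∣)
open import Data.Rational.Properties as ℚ
  using (+-identityˡ; +-identityʳ; +-assoc; +-comm; *-assoc; *-comm; *-zeroˡ; *-zeroʳ;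
         *-distribˡ-+; *-distribʳ-+; *-identityˡ; *-identityʳ)
open import Data.Rational.Solver using (module +-*-Solver)
open import Data.Rational.Unnormalised.Base as ℚᵘ using (mkℚᵘ; *≡*)
import Data.Rational.Unnormalised.Properties as ℚᵘ
open import Data.Fin using (Fin; zero; suc; punchIn; punchOut)
import Data.Fin.Properties as Fin
import Data.Fin.Permutation as Perm
open import Data.List using (List; []; _∷_; length; filter; allFin; lookup)
import Data.List.Properties as List
open import Data.List.Membership.Propositional using (_∈_)
open import Data.List.Membership.Propositional.Properties
  using (∈-filter⁺; ∈-filter⁻; ∈-allFin; ∈-lookup)
import Data.List.Relation.Unary.All as All
open import Data.List.Relation.Unary.AllPairs using ([]; _∷_)
open import Data.List.Relation.Unary.Any using (index)
open import Data.List.Relation.Unary.Any.Properties using (lookup-index)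
open import Data.List.Relation.Unary.Unique.Propositional using (Unique)
import Data.List.Relation.Unary.Unique.Propositional.Properties as Unique
open import Data.Product using (_×_; _,_; proj₁; proj₂; ∃; ∃-syntax)
open import Data.Product.Relation.Binary.Pointwise.NonDependent using (×-setoid)
open import Data.Sum using (inj₁; inj₂)
open import Data.Unit using (tt)
open import Data.Vec as Vec using (Vec; []; _∷_)
import Data.Vec.Properties as Vec
open import Function using (_∘_)
open import Function.Bundles using (Inverse; mk↔ₛ′; _⇔_; mk⇔; Equivalence)
open import Relation.Nullary using (¬_; Dec; yes; no; does)
open import Relation.Nullary.Decidable
  using (¬?; _×-dec_; dec-true; dec-false; decidable-stable)
open import Relation.Nullary.Negation using (contradiction)
open import Relation.Unary using (Pred; Decidable)
open import Relation.Unary.Properties using (U?)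
open import Relation.Binary.Bundles using (Setoid)
import Relation.Binary.Construct.On as On
open import Relation.Binary.PropositionalEquality
  using (_≡_; _≢_; refl; sym; trans; cong; cong₂; subst; subst₂; module ≡-Reasoning)

open +-*-Solver using (solve; _:=_; _:+_; _:*_; :-_; _:-_; con)

-- Rational sums and convolutions

-- B = log A is never formed. All identities are first-order relations between coefficients, and
-- they come from a single recurrence, valid for the structures whose number of components satisfies
-- an arbitrary predicate. The obstacle is that condition (ii) controls only products whose two
-- indices are both at least r. The two ends of the sum for n * a n therefore have to be rewritten
-- exactly, and their main parts must cancel; only the middle is estimated. There the weight k is at
-- most n, which the division by n absorbs, and b ≤ a makes condition (ii) applicable. The
-- coefficients a i in D r n are those of Bender's theorem: exp is its own derivative, so the
-- coefficients of the derivative at B are again those of A. This expresses a through b, and the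
-- identity E A = 1 inverts the relation. If 𝔡 k vanishes for some k ≥ 1, an error bounded by that
-- term would demand an exact equality. Errors are therefore measured along the terms without the
-- factor 𝔡 k, and the literal expansion is deduced when no such 𝔡 k vanishes.

fromℤ-+ : ∀ x y → fromℤ (x ℤ.+ y) ≡ fromℤ x + fromℤ y
-- `z ℚ./ 1` is normalised by a gcd and does not reduce for variable `z`, so the identity is checked
-- on unnormalised fractions.
fromℤ-+ x y = ℚ.toℚᵘ-injective (begin
    ℚ.toℚᵘ (fromℤ (x ℤ.+ y))          ≈⟨ ℚ.toℚᵘ-fromℚᵘ _ ⟩
    mkℚᵘ (x ℤ.+ y) 0
      ≈⟨ *≡* (cong (ℤ._* ℤ.1ℤ) (cong₂ ℤ._+_ (sym (ℤ.*-identityʳ x)) (sym (ℤ.*-identityʳ y)))) ⟩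
    mkℚᵘ x 0 ℚᵘ.+ mkℚᵘ y 0            ≈⟨ ℚᵘ.+-cong (ℚ.toℚᵘ-fromℚᵘ (mkℚᵘ x 0)) (ℚ.toℚᵘ-fromℚᵘ (mkℚᵘ y 0)) ⟨
    ℚ.toℚᵘ (fromℤ x) ℚᵘ.+ ℚ.toℚᵘ (fromℤ y) ≈⟨ ℚ.toℚᵘ-homo-+ (fromℤ x) (fromℤ y) ⟨
    ℚ.toℚᵘ (fromℤ x + fromℤ y)        ∎)
  where open ℚᵘ.≃-Reasoning

fromℤ-* : ∀ x y → fromℤ (x ℤ.* y) ≡ fromℤ x * fromℤ y
fromℤ-* x y = ℚ.toℚᵘ-injective (begin
    ℚ.toℚᵘ (fromℤ (x ℤ.* y))          ≈⟨ ℚ.toℚᵘ-fromℚᵘ _ ⟩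
    mkℚᵘ x 0 ℚᵘ.* mkℚᵘ y 0            ≈⟨ ℚᵘ.*-cong (ℚ.toℚᵘ-fromℚᵘ (mkℚᵘ x 0)) (ℚ.toℚᵘ-fromℚᵘ (mkℚᵘ y 0)) ⟨
    ℚ.toℚᵘ (fromℤ x) ℚᵘ.* ℚ.toℚᵘ (fromℤ y) ≈⟨ ℚ.toℚᵘ-homo-* (fromℤ x) (fromℤ y) ⟨
    ℚ.toℚᵘ (fromℤ x * fromℤ y)        ∎)
  where open ℚᵘ.≃-Reasoning

fromℤ-neg : ∀ x → fromℤ (ℤ.- x) ≡ - fromℤ x
fromℤ-neg x = ℚ.toℚᵘ-injective (begin
    ℚ.toℚᵘ (fromℤ (ℤ.- x))  ≈⟨ ℚ.toℚᵘ-fromℚᵘ _ ⟩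
    ℚᵘ.- mkℚᵘ x 0           ≈⟨ ℚᵘ.-‿cong (ℚ.toℚᵘ-fromℚᵘ (mkℚᵘ x 0)) ⟨
    ℚᵘ.- ℚ.toℚᵘ (fromℤ x)   ≈⟨ ℚ.toℚᵘ-homo‿- (fromℤ x) ⟨
    ℚ.toℚᵘ (- fromℤ x)      ∎)
  where open ℚᵘ.≃-Reasoning

fromℕ-+ : ∀ m n → fromℕ (m ℕ.+ n) ≡ fromℕ m + fromℕ n
fromℕ-+ m n = fromℤ-+ (ℤ.+ m) (ℤ.+ n)

fromℕ-* : ∀ m n → fromℕ (m ℕ.* n) ≡ fromℕ m * fromℕ n
fromℕ-* m n = trans (cong fromℤ (ℤ.pos-* m n)) (fromℤ-* (ℤ.+ m) (ℤ.+ n))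

fromℤ-mono-≤ : ∀ {x y} → x ℤ.≤ y → fromℤ x ℚ.≤ fromℤ y
fromℤ-mono-≤ {x} {y} x≤y = ℚ.toℚᵘ-cancel-≤
  (ℚᵘ.≤-respˡ-≃ (ℚᵘ.≃-sym (ℚ.toℚᵘ-fromℚᵘ (mkℚᵘ x 0)))
    (ℚᵘ.≤-respʳ-≃ (ℚᵘ.≃-sym (ℚ.toℚᵘ-fromℚᵘ (mkℚᵘ y 0)))
      (ℚᵘ.*≤* (ℤ.*-monoʳ-≤-nonNeg ℤ.1ℤ x≤y))))

fromℕ-mono-≤ : ∀ {m n} → m ℕ.≤ n → fromℕ m ℚ.≤ fromℕ n
fromℕ-mono-≤ m≤n = fromℤ-mono-≤ (ℤ.+≤+ m≤n)

0≤fromℕ : ∀ n → 0ℚ ℚ.≤ fromℕ n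
0≤fromℕ n = fromℕ-mono-≤ {0} {n} z≤n

∑-cong : ∀ n {f g : Seq} → (∀ i → i ℕ.< n → f i ≡ g i) → ∑< n f ≡ ∑< n g
∑-cong zero    eq = refl
∑-cong (suc n) eq =
  cong₂ _+_ (∑-cong n (λ i i<n → eq i (ℕ.m<n⇒m<1+n i<n))) (eq n ℕ.≤-refl)

∑-zero : ∀ n {f : Seq} → (∀ i → i ℕ.< n → f i ≡ 0ℚ) → ∑< n f ≡ 0ℚ
∑-zero zero    eq = refl
∑-zero (suc n) eq =
  cong₂ _+_ (∑-zero n (λ i i<n → eq i (ℕ.m<n⇒m<1+n i<n))) (eq n ℕ.≤-refl)

∑-+ : ∀ n (f g : Seq) → ∑< n (λ i → f i + g i) ≡ ∑< n f + ∑< n g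
∑-+ zero    f g = refl
∑-+ (suc n) f g = trans (cong (_+ (f n + g n)) (∑-+ n f g))
  (solve 4 (λ a b c d → (a :+ b) :+ (c :+ d) := (a :+ c) :+ (b :+ d)) refl
    (∑< n f) (∑< n g) (f n) (g n))

∑-*ˡ : ∀ n c (f : Seq) → c * ∑< n f ≡ ∑< n (λ i → c * f i)
∑-*ˡ zero    c f = *-zeroʳ c
∑-*ˡ (suc n) c f = trans (*-distribˡ-+ c (∑< n f) (f n)) (cong (_+ c * f n) (∑-*ˡ n c f))

∑-*ʳ : ∀ n c (f : Seq) → ∑< n f * c ≡ ∑< n (λ i → f i * c)
∑-*ʳ zero    c f = *-zeroˡ c
∑-*ʳ (suc n) c f = trans (*-distribʳ-+ c (∑< n f) (f n)) (cong (_+ f n * c) (∑-*ʳ n c f))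

∑-neg : ∀ n (f : Seq) → ∑< n (λ i → - f i) ≡ - ∑< n f
∑-neg zero    f = refl
∑-neg (suc n) f = trans (cong (_+ - f n) (∑-neg n f)) (sym (ℚ.neg-distrib-+ (∑< n f) (f n)))

∑-split : ∀ m n (f : Seq) → ∑< (m ℕ.+ n) f ≡ ∑< m f + ∑< n (λ i → f (m ℕ.+ i))
∑-split m zero    f = trans (cong (λ k → ∑< k f) (ℕ.+-identityʳ m)) (sym (+-identityʳ _))
∑-split m (suc n) f = trans (cong (λ k → ∑< k f) (ℕ.+-suc m n))
  (trans (cong (_+ f (m ℕ.+ n)) (∑-split m n f)) (+-assoc (∑< m f) _ _))

∑-head : ∀ n (f : Seq) → ∑< (suc n) f ≡ f 0 + ∑< n (f ∘ suc)
∑-head n f = trans (∑-split 1 n f) (cong (_+ ∑< n (f ∘ suc)) (+-identityˡ (f 0)))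

∑-reverse : ∀ n (f : Seq) → ∑< (suc n) f ≡ ∑< (suc n) (λ k → f (n ∸ k))
∑-reverse zero    f = refl
∑-reverse (suc n) f = begin
  ∑< (suc n) f + f (suc n)                     ≡⟨ +-comm (∑< (suc n) f) _ ⟩
  f (suc n) + ∑< (suc n) f                     ≡⟨ cong (f (suc n) +_) (∑-reverse n f) ⟩
  f (suc n) + ∑< (suc n) (λ k → f (n ∸ k))     ≡⟨ ∑-head (suc n) (λ k → f (suc n ∸ k)) ⟨
  ∑< (suc (suc n)) (λ k → f (suc n ∸ k))       ∎
  where open ≡-Reasoning

-- Both sides sum `F k i` over `k + i ≤ r`. Raising `r` by one adds an antidiagonal: each of its
-- entries lengthens one row, and the last one starts a new row.
∑-triangle : ∀ r (F : ℕ → ℕ → ℚ) →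
  ∑< (suc r) (λ t → ∑< (suc t) (λ k → F k (t ∸ k))) ≡
  ∑< (suc r) (λ k → ∑< (suc (r ∸ k)) (F k))
∑-triangle zero    F = refl
∑-triangle (suc r) F = begin
  ∑< (suc r) (λ t → ∑< (suc t) (λ k → F k (t ∸ k))) + (∑< (suc r) diag + diag (suc r))
    ≡⟨ cong (_+ (∑< (suc r) diag + diag (suc r))) (∑-triangle r F) ⟩
  ∑< (suc r) rows + (∑< (suc r) diag + diag (suc r))
    ≡⟨ +-assoc (∑< (suc r) rows) _ _ ⟨
  ∑< (suc r) rows + ∑< (suc r) diag + diag (suc r)
    ≡⟨ cong₂ _+_ (trans (sym (∑-+ (suc r) rows diag)) (∑-cong (suc r) longer)) corner ⟩
  ∑< (suc r) (λ k → ∑< (suc (suc r ∸ k)) (F k)) + ∑< (suc (r ∸ r)) (F (suc r)) ∎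
  where
  open ≡-Reasoning
  diag rows : Seq
  diag k = F k (suc r ∸ k)
  rows k = ∑< (suc (r ∸ k)) (F k)
  longer : ∀ k → k ℕ.< suc r → rows k + diag k ≡ ∑< (suc (suc r ∸ k)) (F k)
  longer k (s≤s k≤r) rewrite ℕ.+-∸-assoc 1 k≤r = refl
  corner : diag (suc r) ≡ ∑< (suc (r ∸ r)) (F (suc r))
  corner rewrite ℕ.n∸n≡0 r = sym (+-identityˡ _)

∑-mono-≤ : ∀ n {f g : Seq} → (∀ i → i ℕ.< n → f i ℚ.≤ g i) → ∑< n f ℚ.≤ ∑< n g
∑-mono-≤ zero    le = ℚ.≤-refl
∑-mono-≤ (suc n) le =
  ℚ.+-mono-≤ (∑-mono-≤ n (λ i i<n → le i (ℕ.m<n⇒m<1+n i<n))) (le n ℕ.≤-refl)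

∑-abs : ∀ n (f : Seq) → ℚ.∣ ∑< n f ∣ ℚ.≤ ∑< n (λ i → ℚ.∣ f i ∣)
∑-abs zero    f = ℚ.≤-refl
∑-abs (suc n) f = ℚ.≤-trans (ℚ.∣p+q∣≤∣p∣+∣q∣ (∑< n f) (f n)) (ℚ.+-monoˡ-≤ ℚ.∣ f n ∣ (∑-abs n f))

infixl 7 _⋆_
_⋆_ : Seq → Seq → Seq
(f ⋆ g) n = ∑< (suc n) (λ k → f k * g (n ∸ k))

-- For `r = n` this is associativity of the Cauchy product. The truncated form holds for all `r` and
-- `n`, since iterated `∸` still adds up its subtrahends.
⋆-assoc : ∀ x y (z : Seq) r n →
  ∑< (suc r) (λ t → (x ⋆ y) t * z (n ∸ t)) ≡
  ∑< (suc r) (λ k → x k * ∑< (suc (r ∸ k)) (λ i → y i * z (n ∸ k ∸ i)))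
⋆-assoc x y z r n = begin
  ∑< (suc r) (λ t → (x ⋆ y) t * z (n ∸ t))
    ≡⟨ ∑-cong (suc r) (λ t _ → trans (∑-*ʳ (suc t) (z (n ∸ t)) _) (∑-cong (suc t) (inner t))) ⟩
  ∑< (suc r) (λ t → ∑< (suc t) (λ k → x k * (y (t ∸ k) * z (n ∸ k ∸ (t ∸ k)))))
    ≡⟨ ∑-triangle r (λ k i → x k * (y i * z (n ∸ k ∸ i))) ⟩
  ∑< (suc r) (λ k → ∑< (suc (r ∸ k)) (λ i → x k * (y i * z (n ∸ k ∸ i))))
    ≡⟨ ∑-cong (suc r) (λ k _ → sym (∑-*ˡ (suc (r ∸ k)) (x k) _)) ⟩
  ∑< (suc r) (λ k → x k * ∑< (suc (r ∸ k)) (λ i → y i * z (n ∸ k ∸ i))) ∎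
  where
  open ≡-Reasoning
  inner : ∀ t k → k ℕ.< suc t →
          x k * y (t ∸ k) * z (n ∸ t) ≡ x k * (y (t ∸ k) * z (n ∸ k ∸ (t ∸ k)))
  inner t k (s≤s k≤t) = trans (*-assoc (x k) _ _) (cong (λ m → x k * (y (t ∸ k) * z m))
    (sym (trans (ℕ.∸-+-assoc n k (t ∸ k)) (cong (n ∸_) (ℕ.m+[n∸m]≡n k≤t)))))

⋆-comm : ∀ x y n → (x ⋆ y) n ≡ (y ⋆ x) n
⋆-comm x y n = trans (∑-reverse n _) (∑-cong (suc n) λ { k (s≤s k≤n) →
  trans (*-comm (x (n ∸ k)) _) (cong (λ m → y m * x (n ∸ k)) (ℕ.m∸[m∸n]≡n k≤n)) })

-- Asymptotics of gargantuan sequences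

*-monoʳ-≤ : ∀ {p q r} → 0ℚ ℚ.≤ p → q ℚ.≤ r → p * q ℚ.≤ p * r
*-monoʳ-≤ {p} 0≤p = ℚ.*-monoˡ-≤-nonNeg p ⦃ ℚ.nonNegative 0≤p ⦄

*-monoˡ-≤ : ∀ {p q r} → 0ℚ ℚ.≤ p → q ℚ.≤ r → q * p ℚ.≤ r * p
*-monoˡ-≤ {p} 0≤p = ℚ.*-monoʳ-≤-nonNeg p ⦃ ℚ.nonNegative 0≤p ⦄

p≤∣p∣ : ∀ p → p ℚ.≤ ∣ p ∣
p≤∣p∣ p with ℚ.≤-total 0ℚ p
... | inj₁ 0≤p = ℚ.≤-reflexive (sym (ℚ.0≤p⇒∣p∣≡p 0≤p))
... | inj₂ p≤0 = ℚ.≤-trans p≤0 (ℚ.0≤∣p∣ p)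

*-nonNeg : ∀ {p q} → 0ℚ ℚ.≤ p → 0ℚ ℚ.≤ q → 0ℚ ℚ.≤ p * q
*-nonNeg {p} 0≤p 0≤q = ℚ.≤-trans (ℚ.≤-reflexive (sym (*-zeroʳ p))) (*-monoʳ-≤ 0≤p 0≤q)

eventually-map : ∀ {P Q : ℕ → Set} → (∀ n → P n → Q n) → Eventually P → Eventually Q
eventually-map f (N , p) = N , λ n N≤n → f n (p n N≤n)

eventually-× : ∀ {P Q : ℕ → Set} → Eventually P → Eventually Q → Eventually (λ n → P n × Q n)
eventually-× (M , p) (N , q) = M ℕ.⊔ N , λ n le →
  p n (ℕ.≤-trans (ℕ.m≤m⊔n M N) le) , q n (ℕ.≤-trans (ℕ.m≤n⊔m M N) le)

eventually-shift : ∀ k {P : ℕ → Set} → Eventually P → Eventually (λ n → P (n ∸ k))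
eventually-shift k (N , p) = N ℕ.+ k , λ n le →
  p (n ∸ k) (ℕ.≤-trans (ℕ.≤-reflexive (sym (ℕ.m+n∸n≡m N k))) (ℕ.∸-monoˡ-≤ k le))

always : ∀ {P : ℕ → Set} → (∀ n → P n) → Eventually P
always p = 0 , λ n _ → p n

O-dominated : ∀ {x y z} → (Eventually λ n → ∣ x n ∣ ℚ.≤ ∣ y n ∣) → y =O z → x =O z
O-dominated x≤y (K , y≤z) =
  K , eventually-map (λ n (p , q) → ℚ.≤-trans p q) (eventually-× x≤y y≤z)

O-cong : ∀ {x y z} → (∀ n → x n ≡ y n) → y =O z → x =O z
O-cong eq = O-dominated (always λ n → ℚ.≤-reflexive (cong ∣_∣ (eq n)))

O-0 : ∀ {z} → (λ _ → 0ℚ) =O z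
O-0 {z} = 0ℚ , always λ n → ℚ.≤-reflexive (sym (*-zeroˡ ∣ z n ∣))

O-+ : ∀ {x y z} → x =O z → y =O z → (λ n → x n + y n) =O z
O-+ {x} {y} {z} (K , p) (L , q) = K + L , eventually-map
  (λ n (p , q) → ℚ.≤-trans (ℚ.∣p+q∣≤∣p∣+∣q∣ (x n) (y n))
    (ℚ.≤-trans (ℚ.+-mono-≤ p q) (ℚ.≤-reflexive (sym (*-distribʳ-+ ∣ z n ∣ K L)))))
  (eventually-× p q)

O-* : ∀ c {x z} → x =O z → (λ n → c * x n) =O z
O-* c {x} {z} (K , p) = ∣ c ∣ * K , eventually-map
  (λ n p → ℚ.≤-trans (ℚ.≤-reflexive (ℚ.∣p*q∣≡∣p∣*∣q∣ c (x n)))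
    (ℚ.≤-trans (*-monoʳ-≤ (ℚ.0≤∣p∣ c) p) (ℚ.≤-reflexive (sym (*-assoc (∣ c ∣) K (∣ z n ∣)))))) p

O-neg : ∀ {x z} → x =O z → (λ n → - x n) =O z
O-neg {x} = O-dominated (always λ n → ℚ.≤-reflexive (ℚ.∣-p∣≡∣p∣ (x n)))

O-abs : ∀ {x z} → x =O z → (λ n → ∣ x n ∣) =O z
O-abs {x} = O-dominated (always λ n → ℚ.≤-reflexive (ℚ.∣∣p∣∣≡∣p∣ (x n)))

O-∑ : ∀ m {f : ℕ → Seq} {z} → (∀ i → i ℕ.< m → f i =O z) → (λ n → ∑< m (λ i → f i n)) =O z
O-∑ zero    p = O-0
O-∑ (suc m) p = O-+ (O-∑ m (λ i i<m → p i (ℕ.m<n⇒m<1+n i<m))) (p m ℕ.≤-refl)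

O-shift : ∀ k {x y} → x =O y → (λ n → x (n ∸ k)) =O (λ n → y (n ∸ k))
O-shift k (K , p) = K , eventually-shift k p

O-boundʳ : ∀ {x y z} → x =O y → (Eventually λ n → ∣ y n ∣ ℚ.≤ ∣ z n ∣) → x =O z
-- The constant in `=O` may be negative, and multiplying the bound `q` by it would then reverse the
-- inequality; hence the absolute value.
O-boundʳ {x} {y} {z} (K , p) q = ∣ K ∣ , eventually-map
  (λ n (p , q) → ℚ.≤-trans p (ℚ.≤-trans (*-monoˡ-≤ (ℚ.0≤∣p∣ (y n)) (p≤∣p∣ K))
                                        (*-monoʳ-≤ (ℚ.0≤∣p∣ K) q)))
  (eventually-× p q)

-- Asymptotic expansion of the connected sequence

module Bender
  (a b e : Seq)
  (0≤a : ∀ n → 0ℚ ℚ.≤ a n) (0≤b : ∀ n → 0ℚ ℚ.≤ b n) (b≤a : ∀ n → b n ℚ.≤ a n)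
  (derivative : ∀ n → fromℕ n * a n ≡ ((λ k → fromℕ k * b k) ⋆ a) n)
  (inverse₀ : (e ⋆ a) 0 ≡ 1ℚ) (inverse : ∀ n → (e ⋆ a) (suc n) ≡ 0ℚ)
  (products : ∀ r → (λ n → ∑[ r ⋯ n ∸ r ] λ k → ∣ a k * a (n ∸ k) ∣) =O (λ n → a (n ∸ r)))
  where

  β : Seq
  β n = fromℕ n * b n

  D : ℕ → Seq
  D r n = a n - ∑< (suc r) (λ i → a i * b (n ∸ i))

  expand : ∀ r n k → a (n ∸ k) ≡ D r (n ∸ k) + ∑< (suc r) (λ i → a i * b (n ∸ k ∸ i))
  expand r n k = solve 2 (λ x y → x := (x :- y) :+ y) refl (a (n ∸ k)) _

  -- Expanding a (n ∸ k) to order r ∸ k makes all error terms O(a (n ∸ suc r)).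
  truncate : ∀ x r n → ∑< (suc r) (λ k → x k * a (n ∸ k)) ≡
    ∑< (suc r) (λ k → x k * D (r ∸ k) (n ∸ k)) + ∑< (suc r) (λ t → (x ⋆ a) t * b (n ∸ t))
  truncate x r n = begin
    ∑< (suc r) (λ k → x k * a (n ∸ k))
      ≡⟨ ∑-cong (suc r) (λ k _ → trans (cong (x k *_) (expand (r ∸ k) n k)) (*-distribˡ-+ (x k) _ _)) ⟩
    ∑< (suc r) (λ k → x k * D (r ∸ k) (n ∸ k) + x k * ∑< (suc (r ∸ k)) (λ i → a i * b (n ∸ k ∸ i)))
      ≡⟨ ∑-+ (suc r) _ _ ⟩
    ∑< (suc r) (λ k → x k * D (r ∸ k) (n ∸ k)) +
      ∑< (suc r) (λ k → x k * ∑< (suc (r ∸ k)) (λ i → a i * b (n ∸ k ∸ i)))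
      ≡⟨ cong (∑< (suc r) (λ k → x k * D (r ∸ k) (n ∸ k)) +_) (⋆-assoc x a b r n) ⟨
    ∑< (suc r) (λ k → x k * D (r ∸ k) (n ∸ k)) + ∑< (suc r) (λ t → (x ⋆ a) t * b (n ∸ t)) ∎
    where open ≡-Reasoning

  rest : ℕ → Seq
  rest r n = ∑< (suc r) (λ k → β k * D (r ∸ k) (n ∸ k))

  middle : ℕ → Seq
  middle s n = ∑[ s ⋯ n ∸ s ] λ k → β k * a (n ∸ k)

  module _ (r m : ℕ) where
    private
      s = suc r
      -- This form says `n ≥ 2s`, so the indices `0 ⋯ n` fall into an initial range of length `s`, a
      -- middle one of length `suc m` and a final one of length `s`.
      n = s ℕ.+ (s ℕ.+ m)
      S T : ℚ
      S = ∑< s (λ i → a i * b (n ∸ i))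
      T = ∑< s (λ i → (β ⋆ a) i * b (n ∸ i))
      f : Seq
      f k = β k * a (n ∸ k)

    private
      middle-range : suc (n ∸ s) ∸ s ≡ suc m
      middle-range = trans (cong (λ k → suc k ∸ s) (ℕ.m+n∸m≡n s (s ℕ.+ m)))
        (trans (cong (_∸ s) (sym (ℕ.+-suc s m))) (ℕ.m+n∸m≡n s (suc m)))

      length-split : s ℕ.+ (suc m ℕ.+ s) ≡ suc n
      length-split = trans (cong (λ k → s ℕ.+ suc k) (ℕ.+-comm m s)) (ℕ.+-suc s (s ℕ.+ m))

      last-index : ∀ i → i ℕ.≤ r → s ℕ.+ (suc m ℕ.+ (r ∸ i)) ≡ n ∸ i
      last-index i i≤r = trans (cong (s ℕ.+_)
          (trans (sym (ℕ.+-∸-assoc (suc m) i≤r))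
                 (cong (_∸ i) (cong suc (ℕ.+-comm m r)))))
        (sym (ℕ.+-∸-assoc s (ℕ.≤-trans i≤r (ℕ.≤-trans (ℕ.n≤1+n r) (ℕ.m≤m+n s m)))))

      i≤n : ∀ {i} → i ℕ.≤ r → i ℕ.≤ n
      i≤n i≤r = ℕ.≤-trans i≤r (ℕ.≤-trans (ℕ.n≤1+n r) (ℕ.m≤m+n s _))

      -- The weight `n ∸ i` is split as `n - i`. The part with `n` belongs to `n * D r n`; in the
      -- other, `derivative i` turns `i * a i` back into a convolution.
      last-term : ∀ i → i ℕ.≤ r →
        f (n ∸ i) ≡ fromℕ n * (a i * b (n ∸ i)) - (β ⋆ a) i * b (n ∸ i)
      last-term i i≤r = begin
        fromℕ (n ∸ i) * b (n ∸ i) * a (n ∸ (n ∸ i))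
          ≡⟨ cong (λ k → fromℕ (n ∸ i) * b (n ∸ i) * a k) (ℕ.m∸[m∸n]≡n (i≤n i≤r)) ⟩
        fromℕ (n ∸ i) * b (n ∸ i) * a i
          ≡⟨ solve 4 (λ x y z w → x :* y :* z := (x :+ w) :* (z :* y) :- w :* z :* y) refl
               (fromℕ (n ∸ i)) (b (n ∸ i)) (a i) (fromℕ i) ⟩
        (fromℕ (n ∸ i) + fromℕ i) * (a i * b (n ∸ i)) - fromℕ i * a i * b (n ∸ i)
          ≡⟨ cong₂ (λ x y → x * (a i * b (n ∸ i)) - y * b (n ∸ i))
               (trans (sym (fromℕ-+ (n ∸ i) i)) (cong fromℕ (ℕ.m∸n+n≡m (i≤n i≤r))))
               (derivative i) ⟩
        fromℕ n * (a i * b (n ∸ i)) - (β ⋆ a) i * b (n ∸ i) ∎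
        where open ≡-Reasoning

      last : ∑< s (λ i → f (s ℕ.+ (suc m ℕ.+ i))) ≡ fromℕ n * S - T
      last = begin
        ∑< s (λ i → f (s ℕ.+ (suc m ℕ.+ i)))
          ≡⟨ ∑-reverse r _ ⟩
        ∑< s (λ i → f (s ℕ.+ (suc m ℕ.+ (r ∸ i))))
          ≡⟨ ∑-cong s (λ { i (s≤s i≤r) → trans (cong f (last-index i i≤r)) (last-term i i≤r) }) ⟩
        ∑< s (λ i → fromℕ n * (a i * b (n ∸ i)) - (β ⋆ a) i * b (n ∸ i))
          ≡⟨ ∑-+ s _ _ ⟩
        ∑< s (λ i → fromℕ n * (a i * b (n ∸ i))) + ∑< s (λ i → - ((β ⋆ a) i * b (n ∸ i)))
          ≡⟨ cong₂ _+_ (sym (∑-*ˡ s (fromℕ n) _)) (∑-neg s _) ⟩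
        fromℕ n * S - T ∎
        where open ≡-Reasoning

    -- `T` enters positively through `truncate` in the initial range and negatively through `last`
    -- in the final one, while `n * S` is what `D` subtracts; both cancel.
    n*D : fromℕ n * D r n ≡ middle s n + rest r n
    n*D = begin
      fromℕ n * (a n - S)
        ≡⟨ solve 3 (λ x y z → x :* (y :- z) := x :* y :- x :* z) refl (fromℕ n) (a n) S ⟩
      fromℕ n * a n - fromℕ n * S
        ≡⟨ cong (_- fromℕ n * S) (begin
           fromℕ n * a n      ≡⟨ derivative n ⟩
           ∑< (suc n) f       ≡⟨ cong (λ k → ∑< k f) length-split ⟨
           ∑< (s ℕ.+ (suc m ℕ.+ s)) f
             ≡⟨ trans (∑-split s _ f) (cong (∑< s f +_) (∑-split (suc m) s _)) ⟩
           ∑< s f + (∑< (suc m) (λ i → f (s ℕ.+ i)) + ∑< s (λ i → f (s ℕ.+ (suc m ℕ.+ i))))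
             ≡⟨ cong₂ (λ x y → x + (∑< (suc m) (λ i → f (s ℕ.+ i)) + y)) (truncate β r n) last ⟩
           rest r n + T + (∑< (suc m) (λ i → f (s ℕ.+ i)) + (fromℕ n * S - T)) ∎) ⟩
      rest r n + T + (∑< (suc m) (λ i → f (s ℕ.+ i)) + (fromℕ n * S - T)) - fromℕ n * S
        ≡⟨ solve 4 (λ x t y z → x :+ t :+ (y :+ (z :- t)) :- z := y :+ x) refl
             (rest r n) T (∑< (suc m) (λ i → f (s ℕ.+ i))) (fromℕ n * S) ⟩
      ∑< (suc m) (λ i → f (s ℕ.+ i)) + rest r n
        ≡⟨ cong (λ k → ∑< k (λ i → f (s ℕ.+ i)) + rest r n) middle-range ⟨
      middle s n + rest r n ∎
      where open ≡-Reasoning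

    private
      P : ℚ
      P = ∑[ s ⋯ n ∸ s ] λ k → ∣ a k * a (n ∸ k) ∣

      -- All terms are nonnegative, so `k ≤ n` and `b k ≤ a k` may be applied termwise; the factor
      -- `n` obtained here is the one `D-bound` cancels.
      middle-≤ : ∣ middle s n ∣ ℚ.≤ fromℕ n * P
      middle-≤ = begin
        ∣ middle s n ∣
          ≤⟨ ∑-abs (suc (n ∸ s) ∸ s) _ ⟩
        ∑< (suc (n ∸ s) ∸ s) (λ i → ∣ f (s ℕ.+ i) ∣)
          ≤⟨ ∑-mono-≤ (suc (n ∸ s) ∸ s) (λ i i< → term-≤ (s ℕ.+ i) (bound i<)) ⟩
        ∑< (suc (n ∸ s) ∸ s) (λ i → fromℕ n * ∣ a (s ℕ.+ i) * a (n ∸ (s ℕ.+ i)) ∣)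
          ≡⟨ ∑-*ˡ (suc (n ∸ s) ∸ s) (fromℕ n) _ ⟨
        fromℕ n * P ∎
        where
        open ℚ.≤-Reasoning
        bound : ∀ {i} → i ℕ.< suc (n ∸ s) ∸ s → s ℕ.+ i ℕ.≤ n
        bound {i} i< rewrite middle-range = ℕ.+-monoʳ-≤ s (ℕ.≤-trans (ℕ.≤-pred i<) (ℕ.m≤n+m m s))
        term-≤ : ∀ k → k ℕ.≤ n → ∣ f k ∣ ℚ.≤ fromℕ n * ∣ a k * a (n ∸ k) ∣
        term-≤ k k≤n = begin
          ∣ f k ∣
            ≡⟨ ℚ.0≤p⇒∣p∣≡p (*-nonNeg (*-nonNeg (0≤fromℕ k) (0≤b k)) (0≤a (n ∸ k))) ⟩
          fromℕ k * b k * a (n ∸ k)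
            ≤⟨ *-monoˡ-≤ (0≤a (n ∸ k)) (ℚ.≤-trans (*-monoˡ-≤ (0≤b k) (fromℕ-mono-≤ k≤n))
                                                  (*-monoʳ-≤ (0≤fromℕ n) (b≤a k))) ⟩
          fromℕ n * a k * a (n ∸ k)
            ≡⟨ *-assoc (fromℕ n) (a k) (a (n ∸ k)) ⟩
          fromℕ n * (a k * a (n ∸ k))
            ≤⟨ *-monoʳ-≤ (0≤fromℕ n) (p≤∣p∣ _) ⟩
          fromℕ n * ∣ a k * a (n ∸ k) ∣ ∎

    -- `rest` carries no factor `n`, but `1 ≤ n` allows one to be inserted, after which `n` cancels
    -- throughout.
    D-bound : ∣ D r n ∣ ℚ.≤ P + ∣ rest r n ∣
    D-bound = ℚ.*-cancelˡ-≤-pos (fromℕ n) ⦃ ℚ.positive 0<n ⦄ (begin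
      fromℕ n * ∣ D r n ∣
        ≡⟨ cong (_* ∣ D r n ∣) (ℚ.0≤p⇒∣p∣≡p (0≤fromℕ n)) ⟨
      ∣ fromℕ n ∣ * ∣ D r n ∣
        ≡⟨ ℚ.∣p*q∣≡∣p∣*∣q∣ (fromℕ n) (D r n) ⟨
      ∣ fromℕ n * D r n ∣
        ≡⟨ cong ∣_∣ n*D ⟩
      ∣ middle s n + rest r n ∣
        ≤⟨ ℚ.∣p+q∣≤∣p∣+∣q∣ (middle s n) (rest r n) ⟩
      ∣ middle s n ∣ + ∣ rest r n ∣
        ≤⟨ ℚ.+-mono-≤ middle-≤ (ℚ.≤-trans (ℚ.≤-reflexive (sym (*-identityˡ _)))
                                          (*-monoˡ-≤ (ℚ.0≤∣p∣ (rest r n)) 1≤n)) ⟩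
      fromℕ n * P + fromℕ n * ∣ rest r n ∣
        ≡⟨ *-distribˡ-+ (fromℕ n) P ∣ rest r n ∣ ⟨
      fromℕ n * (P + ∣ rest r n ∣) ∎)
      where
      open ℚ.≤-Reasoning
      1≤n : 1ℚ ℚ.≤ fromℕ n
      1≤n = fromℕ-mono-≤ {1} {n} (s≤s z≤n)
      0<n : 0ℚ ℚ.< fromℕ n
      0<n = ℚ.<-≤-trans (ℚ.positive⁻¹ 1ℚ) 1≤n

  -- A shift by `k` and an error of order `r ∸ k` combine to order `r`: this is why `truncate`
  -- expands the `k`-th term only to order `r ∸ k`.
  shifted : ∀ {r k x} → k ℕ.≤ r → x =O (λ n → a (n ∸ suc (r ∸ k))) →
            (λ n → x (n ∸ k)) =O (λ n → a (n ∸ suc r))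
  shifted {r} {k} k≤r p = O-boundʳ (O-shift k p) (always λ n → ℚ.≤-reflexive (cong (λ i → ∣ a i ∣)
    (trans (ℕ.∸-+-assoc n k (suc (r ∸ k)))
           (cong (n ∸_) (trans (ℕ.+-suc k (r ∸ k)) (cong suc (ℕ.m+[n∸m]≡n k≤r)))))))

  D-O : ∀ r → D r =O (λ n → a (n ∸ suc r))
  D-O = <-rec _ step
    where
    step : ∀ r → (∀ {k} → k ℕ.< r → D k =O (λ n → a (n ∸ suc k))) → D r =O (λ n → a (n ∸ suc r))
    step r ih = O-dominated
      (suc r ℕ.+ suc r , λ n le → ℚ.≤-trans (bound n le) (p≤∣p∣ _))
      (O-+ (products (suc r)) (O-abs (O-∑ (suc r) term)))
      where
      bound : ∀ n → suc r ℕ.+ suc r ℕ.≤ n →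
        ∣ D r n ∣ ℚ.≤ (∑[ suc r ⋯ n ∸ suc r ] λ k → ∣ a k * a (n ∸ k) ∣) + ∣ rest r n ∣
      bound n le with ℕ.m≤n⇒∃[o]m+o≡n le
      ... | m , refl = subst
        (λ n → ∣ D r n ∣ ℚ.≤ (∑[ suc r ⋯ n ∸ suc r ] λ k → ∣ a k * a (n ∸ k) ∣) + ∣ rest r n ∣)
        (sym (ℕ.+-assoc (suc r) (suc r) m)) (D-bound r m)
      term : ∀ k → k ℕ.< suc r → (λ n → β k * D (r ∸ k) (n ∸ k)) =O (λ n → a (n ∸ suc r))
      -- The summand for `k = 0` contains `D r` itself, to which the induction hypothesis does not
      -- apply, but its coefficient `β 0` is zero.
      term zero    _         = O-cong (λ n → trans (cong (_* D r n) (*-zeroˡ (b 0))) (*-zeroˡ (D r n))) O-0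
      term (suc k) (s≤s k<r) = O-* (β (suc k)) (shifted {r} {suc k} {D (r ∸ suc k)} k<r
        (ih (ℕ.∸-monoʳ-< {r} {suc k} {0} (s≤s z≤n) k<r)))

  expansion : ∀ r → (λ n → b n - ∑< (suc r) (λ k → e k * a (n ∸ k))) =O (λ n → a (n ∸ suc r))
  expansion r = O-cong eq (O-neg (O-∑ (suc r) λ { k (s≤s k≤r) →
      O-* (e k) (shifted {r} {k} {D (r ∸ k)} k≤r (D-O (r ∸ k))) }))
    where
    open ≡-Reasoning
    eq : ∀ n → b n - ∑< (suc r) (λ k → e k * a (n ∸ k)) ≡
               - ∑< (suc r) (λ k → e k * D (r ∸ k) (n ∸ k))
    eq n = begin
      b n - ∑< (suc r) (λ k → e k * a (n ∸ k))
        ≡⟨ cong (λ x → b n - x) (truncate e r n) ⟩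
      b n - (X + ∑< (suc r) (λ t → (e ⋆ a) t * b (n ∸ t)))
        ≡⟨ cong (λ x → b n - (X + x)) (trans (∑-head r _) (cong₂ _+_
             (trans (cong (_* b n) inverse₀) (*-identityˡ (b n)))
             (∑-zero r (λ t _ → trans (cong (_* b (n ∸ suc t)) (inverse t)) (*-zeroˡ (b (n ∸ suc t))))))) ⟩
      b n - (X + (b n + 0ℚ))
        ≡⟨ solve 2 (λ x y → y :- (x :+ (y :+ con 0ℚ)) := :- x) refl X (b n) ⟩
      - X ∎
      where X = ∑< (suc r) (λ k → e k * D (r ∸ k) (n ∸ k))

-- Cardinalities of finite setoids

lookup-injective : ∀ {A : Set} {xs : List A} → Unique xs →
                   ∀ {i j} → lookup xs i ≡ lookup xs j → i ≡ j
lookup-injective (px ∷ u) {zero}  {zero}  eq = refl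
lookup-injective (px ∷ u) {zero}  {suc j} eq = contradiction eq (All.lookup px (∈-lookup j))
lookup-injective (px ∷ u) {suc i} {zero}  eq = contradiction (sym eq) (All.lookup px (∈-lookup i))
lookup-injective (px ∷ u) {suc i} {suc j} eq = cong suc (lookup-injective u eq)

Respects : (S : Setoid 0ℓ 0ℓ) → Pred (Setoid.Carrier S) 0ℓ → Set
Respects S P = ∀ {x y} → Setoid._≈_ S x y → P x → P y

-- Equality ignores the proofs of `P`, so a structure is counted once however many proofs it has.
restrict : (S : Setoid 0ℓ 0ℓ) → Pred (Setoid.Carrier S) 0ℓ → Setoid 0ℓ 0ℓ
restrict S P = On.setoid {B = ∃ P} S proj₁

module _ {S : Setoid 0ℓ 0ℓ} (fin : Finite S) {P : Pred (Setoid.Carrier S) 0ℓ}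
         (P? : Decidable P) (resp : Respects S P) where
  private
    module S = Setoid S
    open Finite fin
    module E = Inverse enum
    Q? = λ i → P? (E.from i)
    xs = filter Q? (allFin card)

    member : ∀ k → P (E.from (lookup xs k))
    member k = proj₂ (∈-filter⁻ Q? {xs = allFin card} (∈-lookup k))

    unique : Unique xs
    unique = Unique.filter⁺ Q? (Unique.allFin⁺ card)

    from-to : ∀ s → S._≈_ s (E.from (E.to s))
    from-to s = S.sym (E.strictlyInverseʳ s)

    mem : ∀ ((s , p) : ∃ P) → E.to s ∈ xs
    mem (s , p) = ∈-filter⁺ Q? (∈-allFin (E.to s)) (resp (from-to s) p)

  -- `#` filters a list of representatives; exhibiting it as the cardinality of a setoid lets counts
  -- be compared through bijections. `resp` carries `P` from a structure to its representative.
  finite-restrict : Finite (restrict S P)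
  finite-restrict = record
    { card = # P?
    ; enum = record
      { to = λ x → index (mem x)
      ; from = λ k → E.from (lookup xs k) , member k
      ; to-cong = λ {x} {y} eq → lookup-injective unique
          (trans (sym (lookup-index (mem x))) (trans (E.to-cong eq) (lookup-index (mem y))))
      ; from-cong = λ { refl → S.refl }
      ; inverse =
          (λ {k} {x} eq → lookup-injective unique
            (trans (sym (lookup-index (mem x)))
              (trans (E.to-cong eq) (E.strictlyInverseˡ (lookup xs k)))))
        , (λ {x} {k} → λ { refl → S.trans (S.reflexive (cong E.from (sym (lookup-index (mem x)))))
                                          (E.strictlyInverseʳ (proj₁ x)) })
      }
    }

finite-× : ∀ {S T} → Finite S → Finite T → Finite (×-setoid S T)
finite-× {S} {T} f g = record
  { card = F.card ℕ.* G.card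
  ; enum = record
    { to = λ (s , t) → Inverse.from Fin.*↔× (F.to s , G.to t)
    ; from = λ k → let i , j = Inverse.to (Fin.*↔× {F.card}) k in F.from i , G.from j
    ; to-cong = λ (p , q) → cong (Inverse.from Fin.*↔×) (cong₂ _,_ (F.to-cong p) (G.to-cong q))
    ; from-cong = λ { refl → Setoid.refl S , Setoid.refl T }
    ; inverse =
        (λ {k} (p , q) → trans
          (cong (Inverse.from Fin.*↔×)
            (cong₂ _,_ (F.inverseˡ p) (G.inverseˡ q)))
          (Inverse.strictlyInverseʳ (Fin.*↔× {F.card}) k))
      , (λ {(s , t)} → λ { refl →
            let eq = Inverse.strictlyInverseˡ (Fin.*↔× {F.card}) (F.to s , G.to t) in
            F.inverseʳ (cong proj₁ eq) , G.inverseʳ (cong proj₂ eq) })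
    }
  }
  where
  module F where

    open Finite f public
    open Inverse enum public
  module G where
    open Finite g public
    open Inverse enum public

module _ {S T : Setoid 0ℓ 0ℓ} (f : Finite S) (g : Finite T) where
  private
    module S = Setoid S
    module T = Setoid T
    module F = Inverse (Finite.enum f)
    module G = Inverse (Finite.enum g)

  card-≤ : (h : S.Carrier → T.Carrier) → (∀ {x y} → T._≈_ (h x) (h y) → S._≈_ x y) →
           Finite.card f ℕ.≤ Finite.card g
  card-≤ h inj = Fin.injective⇒≤ {f = G.to ∘ h ∘ F.from} λ {i} {j} eq →
    trans (sym (F.strictlyInverseˡ i))
      (trans (F.to-cong (inj (T.trans (T.sym (G.strictlyInverseʳ _))
                           (T.trans (T.reflexive (cong G.from eq)) (G.strictlyInverseʳ _)))))
             (F.strictlyInverseˡ j))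

card-≡ : ∀ {S T} (f : Finite S) (g : Finite T) →
         let module S = Setoid S ; module T = Setoid T in
         (h : S.Carrier → T.Carrier) → (∀ {x y} → T._≈_ (h x) (h y) → S._≈_ x y) →
         (∀ {x y} → S._≈_ x y → T._≈_ (h x) (h y)) →
         (∀ t → ∃[ s ] T._≈_ (h s) t) →
         Finite.card f ≡ Finite.card g
card-≡ {S} {T} f g h inj hcong surj = ℕ.≤-antisym
  (card-≤ f g h inj)
  (card-≤ g f (proj₁ ∘ surj) λ {x} {y} eq →
    T.trans (T.sym (proj₂ (surj x))) (T.trans (hcong eq) (proj₂ (surj y))))
  where module T = Setoid T

open ∘-Str
open _≋_

-- Splitting off a component

module _ (F : Functor) where
  private module F = Functor F

  act-injective : ∀ {U V} (σ : U ≅ V) {s t : F.Str U} →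
                  F._≈_ {V} (F.act σ s) (F.act σ t) → F._≈_ {U} s t
  act-injective {U} σ {s} {t} eq =
    S.trans (S.sym (back s)) (S.trans (F.act-cong (≅-sym σ) eq) (back t))
    where
    module S = Setoid (F.obj U)
    back : ∀ s → F._≈_ {U} (F.act (≅-sym σ) (F.act σ s)) s
    back s = S.trans (F.act-via (≅-sym σ) σ ≅-id (_≅_.strictlyInverseʳ σ) s) (F.act-id s)

remove-zero : ∀ {k l} (φ : [ suc k ] ≅ [ suc l ]) → to φ zero ≡ zero →
              ∃[ ψ ] (∀ i → to φ (suc i) ≡ suc (to {[ k ]} {[ l ]} ψ i))
remove-zero (bij π) π0≡0 = bij (Perm.remove zero π) , λ i →
  trans (Perm.punchIn-permute π zero i)
        (cong (λ z → punchIn z (Inverse.to (Perm.remove zero π) i)) π0≡0)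

-- `join` numbers the distinguished block 0, while a given structure may number it `i₀`; this
-- relabelling sends 0 to `i₀` and keeps the other blocks in order.
insertAt : ∀ {k} → Fin (suc k) → [ suc k ] ≅ [ suc k ]
insertAt {k} i₀ = bij (mk↔ₛ′ f g fg gf)
  where
  f : Fin (suc k) → Fin (suc k)
  f zero    = i₀
  f (suc j) = punchIn i₀ j
  g : Fin (suc k) → Fin (suc k)
  g i with i₀ Fin.≟ i
  ... | yes _   = zero
  ... | no i₀≢i = suc (punchOut i₀≢i)
  fg : ∀ i → f (g i) ≡ i
  fg i with i₀ Fin.≟ i
  ... | yes i₀≡i = i₀≡i
  ... | no i₀≢i  = Fin.punchIn-punchOut i₀≢i
  gf : ∀ i → g (f i) ≡ i
  gf zero with i₀ Fin.≟ i₀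
  ... | yes _    = refl
  ... | no i₀≢i₀ = contradiction refl i₀≢i₀
  gf (suc j) with i₀ Fin.≟ punchIn i₀ j
  ... | yes eq = contradiction (sym eq) (Fin.punchInᵢ≢i i₀ j)
  ... | no neq = cong suc (trans (Fin.punchOut-cong i₀ refl) (Fin.punchOut-punchIn i₀))

lift : ∀ {k l} → [ k ] ≅ [ l ] → [ suc k ] ≅ [ suc l ]
lift (bij π) = bij (Perm.lift₀ π)

-- q⁻¹(0) is the set of elements that the block of u₀ is required to have.
module Splitting (G : Functor) (U : FinSet) (u₀ : ∣ U ∣ˢ)
                 (q : ∣ U ∣ˢ → Fin 2) (qu₀ : q u₀ ≡ zero) where
  private module G = Functor G

  F₀ F₁ : FinSet
  F₀ = fibre U q zero
  F₁ = fibre U q (suc zero)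

  OStr : FinSet → Set
  OStr = ∘-Str (functor ℰ) G

  Marked : OStr U → Set
  Marked x = ∀ u → q u ≡ zero ⇔ block x u ≡ block x u₀

  module Join (y : OStr F₁) where
    -- The value of `q u` and its equation are separate arguments: lemmas can then match on `i` and
    -- still hold the proof that `u` lies in `F₁`, which `block y` needs.
    glue : ∀ u i → q u ≡ i → Fin (suc (blocks y))
    glue u zero       e = zero
    glue u (suc zero) e = suc (block y (u , e))

    blk : ∣ U ∣ˢ → Fin (suc (blocks y))
    blk u = glue u (q u) refl

    private
      glue₀ : ∀ u i (e : q u ≡ i) → q u ≡ zero → glue u i e ≡ zero
      glue₀ u zero e e₀ = refl
      glue₀ u (suc zero) e e₀ with () ← trans (sym e) e₀

      glue₁ : ∀ u i (e : q u ≡ i) (e₁ : q u ≡ suc zero) →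
              glue u i e ≡ suc (block y (u , e₁))
      glue₁ u zero e e₁ with () ← trans (sym e) e₁
      glue₁ u (suc zero) e e₁ = cong (suc ∘ block y) (Sub-≡ q refl)

      glue-inv : ∀ u i (e : q u ≡ i) {j} → glue u i e ≡ suc j →
                 ∃[ e₁ ] block y (u , e₁) ≡ j
      glue-inv u zero       e ()
      glue-inv u (suc zero) e refl = e , refl

      glue-inv₀ : ∀ u i (e : q u ≡ i) → glue u i e ≡ zero → q u ≡ zero
      glue-inv₀ u zero       e _ = e
      glue-inv₀ u (suc zero) e ()

    blk₀ : ∀ {u} → q u ≡ zero → blk u ≡ zero
    blk₀ e = glue₀ _ _ refl e

    blk₁ : ∀ {u} (e : q u ≡ suc zero) → blk u ≡ suc (block y (u , e))
    blk₁ e = glue₁ _ _ refl e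

    blk₀⁻¹ : ∀ {u} → blk u ≡ zero → q u ≡ zero
    blk₀⁻¹ e = glue-inv₀ _ _ refl e

    blk₁⁻¹ : ∀ {u j} → blk u ≡ suc j → ∃[ e ] block y (u , e) ≡ j
    blk₁⁻¹ e = glue-inv _ _ refl e

    iso₀ : F₀ ≅ fibre U blk zero
    iso₀ = bij (mk↔ₛ′ (λ (u , e) → u , blk₀ e) (λ (u , e) → u , blk₀⁻¹ e)
      (λ _ → Sub-≡ blk refl) (λ _ → Sub-≡ q refl))

    iso₁ : ∀ j → fibre F₁ (block y) j ≅ fibre U blk (suc j)
    iso₁ j = bij (mk↔ₛ′
      (λ ((u , e) , e′) → u , trans (blk₁ e) (cong suc e′))
      (λ (u , e) → let e₁ , e′ = blk₁⁻¹ e in (u , e₁) , e′)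
      (λ _ → Sub-≡ blk refl)
      (λ _ → Sub-≡ (block y) (Sub-≡ q refl)))

  open Join

  join : G.Str F₀ → OStr F₁ → OStr U
  join b y = record
    { blocks = suc (blocks y)
    ; block  = blk y
    ; onto   = λ where
        zero    → u₀ , blk₀ y qu₀
        (suc j) → let (u , e) , e′ = onto y j in u , trans (blk₁ y e) (cong suc e′)
    ; outer  = tt
    ; inner  = λ where
        zero    → G.act (iso₀ y) b
        (suc j) → G.act (iso₁ y j) (inner y j)
    }

  join-marked : ∀ b y → Marked (join b y)
  join-marked b y u = mk⇔
    (λ e → trans (blk₀ y e) (sym (blk₀ y qu₀)))
    (λ e → blk₀⁻¹ y (trans e (blk₀ y qu₀)))

  join-cong : ∀ {b b′ y y′} → G._≈_ {F₀} b b′ → _≋_ (functor ℰ) G y y′ →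
              _≋_ (functor ℰ) G (join b y) (join b′ y′)
  join-cong {b} {b′} {y} {y′} b≈b′ r = record
    { relabel = lift (relabel r)
    ; block-≡ = λ u → sq u (q u) refl
    ; outer-≈ = refl
    ; inner-≈ = λ where
        zero →
          let module Z = Setoid (G.obj (fibre U (blk y′) zero)) in
          Z.trans (G.act-via _ (iso₀ y) (iso₀ y′) (λ _ → Sub-≡ (blk y′) refl) b)
                  (G.act-cong (iso₀ y′) b≈b′)
        (suc i) →
          let j = to (relabel r) i
              module Z = Setoid (G.obj (fibre U (blk y′) (suc j)))
              f = fibre≅ ≅-id (relabel r) (block-≡ r) refl
          in Z.trans (G.act-via _ (iso₁ y i) (iso₁ y′ j ∘≅ f)
                       (λ _ → Sub-≡ (blk y′) refl) _)
             (Z.trans (G.act-∘ (iso₁ y′ j) f _)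
                      (G.act-cong (iso₁ y′ j) (inner-≈ r i)))
    }
    where
    sq : ∀ u i → q u ≡ i → blk y′ u ≡ to (lift (relabel r)) (blk y u)
    sq u zero       e = trans (blk₀ y′ e) (cong (to (lift (relabel r))) (sym (blk₀ y e)))
    sq u (suc zero) e = trans (blk₁ y′ e) (trans (cong suc (block-≡ r (u , e)))
      (cong (to (lift (relabel r))) (sym (blk₁ y e))))

  -- The point `u₀` lies in block 0 of both joins, so the relabelling fixes 0 and restricts to the
  -- remaining blocks. The inner equalities are then pulled back along `iso₀` and `iso₁`.
  join-injective : ∀ {b b′ y y′} → _≋_ (functor ℰ) G (join b y) (join b′ y′) →
                   G._≈_ {F₀} b b′ × _≋_ (functor ℰ) G y y′
  join-injective {b} {b′} {y} {y′} r = b≈b′ , record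
    { relabel = ψ
    ; block-≡ = sq
    ; outer-≈ = refl
    ; inner-≈ = λ i →
        let j = to ψ i
            module Z = Setoid (G.obj (fibre U (blk y′) (suc j)))
        in act-injective G (iso₁ y′ j)
             (Z.trans (Z.sym (G.act-∘ (iso₁ y′ j) _ _))
             (Z.trans (Z.sym (G.act-via _ (iso₁ y i) _ (λ _ → Sub-≡ (blk y′) refl) _))
                      (inner-≈′ (functor ℰ) G r (ψ-suc i))))
    }
    where
    φ = relabel r
    φ0 : to φ zero ≡ zero
    φ0 = trans (cong (to φ) (sym (blk₀ y qu₀))) (trans (sym (block-≡ r u₀)) (blk₀ y′ qu₀))
    ψ = proj₁ (remove-zero φ φ0)
    ψ-suc = proj₂ (remove-zero φ φ0)
    sq : ∀ u → block y′ u ≡ to ψ (block y u)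
    sq (u , e) = Fin.suc-injective (trans (sym (blk₁ y′ e))
      (trans (block-≡ r u) (trans (cong (to φ) (blk₁ y e)) (ψ-suc _))))
    module Z₀ = Setoid (G.obj (fibre U (blk y′) zero))
    b≈b′ : G._≈_ {F₀} b b′
    b≈b′ = act-injective G (iso₀ y′)
      (Z₀.trans (Z₀.sym (G.act-via _ (iso₀ y) (iso₀ y′) (λ _ → Sub-≡ (blk y′) refl) b))
               (inner-≈′ (functor ℰ) G r φ0))

  -- The fields of the structure are separate parameters, so that its number of blocks is literally
  -- `suc k` and `punchOut` can remove the block of `u₀`.
  module Split (k : ℕ) (p : ∣ U ∣ˢ → Fin (suc k)) (p-onto : ∀ i → ∃[ u ] p u ≡ i)
               (p-inner : ∀ i → G.Str (fibre U p i))
               (mark : ∀ u → q u ≡ zero ⇔ p u ≡ p u₀) where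
    private
      i₀ = p u₀

      x : OStr U
      x = record { blocks = suc k ; block = p ; onto = p-onto ; outer = tt ; inner = p-inner }

      q≢0 : ∀ {u} → q u ≡ suc zero → i₀ ≢ p u
      q≢0 {u} e eq with () ← trans (sym e) (Equivalence.from (mark u) (sym eq))

      q≡1 : ∀ {u} → p u ≢ i₀ → q u ≡ suc zero
      q≡1 {u} ne with q u in eq
      ... | zero     = contradiction (Equivalence.to (mark u) eq) ne
      ... | suc zero = refl

    block′ : ∣ F₁ ∣ˢ → Fin k
    block′ (u , e) = punchOut (q≢0 e)

    punchIn-block′ : ∀ {u} (e : q u ≡ suc zero) → punchIn i₀ (block′ (u , e)) ≡ p u
    punchIn-block′ e = Fin.punchIn-punchOut (q≢0 e)

    off : ∀ {u j} → p u ≡ punchIn i₀ j → q u ≡ suc zero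
    off e = q≡1 (λ eq → Fin.punchInᵢ≢i i₀ _ (trans (sym e) eq))

    block′-≡ : ∀ {u j} (e : p u ≡ punchIn i₀ j) → block′ (u , off e) ≡ j
    block′-≡ e = Fin.punchIn-injective i₀ _ _ (trans (punchIn-block′ (off e)) e)

    iso₀′ : fibre U p i₀ ≅ F₀
    iso₀′ = bij (mk↔ₛ′
      (λ (u , e) → u , Equivalence.from (mark u) e)
      (λ (u , e) → u , Equivalence.to (mark u) e)
      (λ _ → Sub-≡ q refl) (λ _ → Sub-≡ p refl))

    iso₁′ : ∀ j → fibre U p (punchIn i₀ j) ≅ fibre F₁ block′ j
    iso₁′ j = bij (mk↔ₛ′
      (λ (u , e) → (u , off e) , block′-≡ e)
      (λ ((u , e) , e′) → u , trans (sym (punchIn-block′ e)) (cong (punchIn i₀) e′))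
      (λ _ → Sub-≡ block′ (Sub-≡ q refl)) (λ _ → Sub-≡ p refl))

    fst : G.Str F₀
    fst = G.act iso₀′ (p-inner i₀)

    rest : OStr F₁
    rest = record
      { blocks = k
      ; block  = block′
      ; onto   = λ j → let u , e = p-onto (punchIn i₀ j) in (u , off e) , block′-≡ e
      ; outer  = tt
      ; inner  = λ j → G.act (iso₁′ j) (p-inner (punchIn i₀ j))
      }

    join-split : _≋_ (functor ℰ) G (join fst rest) x
    join-split = record
      { relabel = insertAt i₀
      ; block-≡ = λ u → sq u (q u) refl
      ; outer-≈ = refl
      ; inner-≈ = λ where
          zero →
            let module Z = Setoid (G.obj (fibre U p i₀)) in
            Z.trans (G.act-via _ (iso₀ rest) (≅-sym iso₀′) (λ _ → Sub-≡ p refl) _)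
            (Z.trans (G.act-via (≅-sym iso₀′) iso₀′ ≅-id (λ _ → Sub-≡ p refl) _)
                     (G.act-id _))
          (suc j) →
            let module Z = Setoid (G.obj (fibre U p (punchIn i₀ j))) in
            Z.trans (G.act-via _ (iso₁ rest j) (≅-sym (iso₁′ j)) (λ _ → Sub-≡ p refl) _)
            (Z.trans (G.act-via (≅-sym (iso₁′ j)) (iso₁′ j) ≅-id (λ _ → Sub-≡ p refl) _)
                     (G.act-id _))
      }
      where
      sq : ∀ u i → q u ≡ i → p u ≡ to (insertAt i₀) (blk rest u)
      sq u zero       e = trans (Equivalence.to (mark u) e)
                                (cong (to (insertAt i₀)) (sym (blk₀ rest e)))
      sq u (suc zero) e = trans (sym (punchIn-block′ e))
                                (cong (to (insertAt i₀)) (sym (blk₁ rest e)))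

  split : (x : OStr U) → Marked x →
          ∃[ b ] ∃[ y ] (_≋_ (functor ℰ) G (join b y) x × suc (blocks y) ≡ blocks x)
  split record { blocks = zero ; block = p } mark with () ← p u₀
  split record { blocks = suc k ; block = p ; onto = o ; inner = f } mark =
    S.fst , S.rest , S.join-split , refl
    where module S = Split k p o f mark

-- Counting structures by the number of components

-- A vector over Fin 2 encodes a subset, zero marking its elements.
∑V : ∀ n → (Vec (Fin 2) n → ℚ) → ℚ
∑V zero    f = f []
∑V (suc n) f = ∑V n (f ∘ (zero ∷_)) + ∑V n (f ∘ (suc zero ∷_))

∑V-cong : ∀ n {f g : Vec (Fin 2) n → ℚ} → (∀ v → f v ≡ g v) → ∑V n f ≡ ∑V n g
∑V-cong zero    eq = eq []
∑V-cong (suc n) eq = cong₂ _+_ (∑V-cong n (eq ∘ _)) (∑V-cong n (eq ∘ _))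

∑V-0 : ∀ n → ∑V n (λ _ → 0ℚ) ≡ 0ℚ
∑V-0 zero    = refl
∑V-0 (suc n) = cong₂ _+_ (∑V-0 n) (∑V-0 n)

∑V-+ : ∀ n (f g : Vec (Fin 2) n → ℚ) → ∑V n (λ v → f v + g v) ≡ ∑V n f + ∑V n g
∑V-+ zero    f g = refl
∑V-+ (suc n) f g = trans (cong₂ _+_ (∑V-+ n _ _) (∑V-+ n _ _))
  (solve 4 (λ a b c d → (a :+ b) :+ (c :+ d) := (a :+ c) :+ (b :+ d)) refl
    (∑V n (f ∘ (zero ∷_))) (∑V n (g ∘ (zero ∷_)))
    (∑V n (f ∘ (suc zero ∷_))) (∑V n (g ∘ (suc zero ∷_))))

∑V-δ : ∀ n (f : Vec (Fin 2) n → ℚ) w → f w ≡ 1ℚ → (∀ v → v ≢ w → f v ≡ 0ℚ) → ∑V n f ≡ 1ℚ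
∑V-δ zero    f []             f1 f0 = f1
∑V-δ (suc n) f (zero ∷ w)     f1 f0 = cong₂ _+_
  (∑V-δ n _ w f1 (λ v v≢w → f0 _ (v≢w ∘ Vec.∷-injectiveʳ)))
  (trans (∑V-cong n (λ v → f0 _ λ ())) (∑V-0 n))
∑V-δ (suc n) f (suc zero ∷ w) f1 f0 = cong₂ _+_
  (trans (∑V-cong n (λ v → f0 _ λ ())) (∑V-0 n))
  (∑V-δ n _ w f1 (λ v v≢w → f0 _ (v≢w ∘ Vec.∷-injectiveʳ)))

occurrences : ∀ {n} → Fin 2 → Vec (Fin 2) n → ℕ
occurrences i = Vec.count (Fin._≟ i)

-- Pascal's rule: a leading `zero` raises the count by one, a leading `suc zero` leaves it
-- unchanged.
∑V-binomial : ∀ n (f : Seq) →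
  ∑V n (f ∘ occurrences zero) ≡ ∑< (suc n) (λ j → fromℕ (n C j) * f j)
∑V-binomial zero    f = sym (trans (+-identityˡ _) (*-identityˡ (f 0)))
∑V-binomial (suc n) f = begin
  ∑V n (f ∘ suc ∘ occurrences zero) + ∑V n (f ∘ occurrences zero)
    ≡⟨ cong₂ _+_ (∑V-binomial n (f ∘ suc)) (∑V-binomial n f) ⟩
  X + ∑< (suc n) (λ j → fromℕ (n C j) * f j)
    ≡⟨ cong (X +_) (sym (trans (cong (∑< (suc n) (λ j → fromℕ (n C j) * f j) +_) last)
                               (+-identityʳ _))) ⟩
  X + ∑< (suc (suc n)) (λ j → fromℕ (n C j) * f j)
    ≡⟨ cong (X +_) (∑-head (suc n) _) ⟩
  X + (fromℕ (n C 0) * f 0 + Y)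
    ≡⟨ solve 3 (λ x y z → x :+ (y :+ z) := y :+ (x :+ z)) refl X (fromℕ (n C 0) * f 0) Y ⟩
  fromℕ (n C 0) * f 0 + (X + Y)
    ≡⟨ cong (fromℕ (n C 0) * f 0 +_) (trans (sym (∑-+ (suc n) _ _)) (∑-cong (suc n) λ j _ →
         trans (sym (*-distribʳ-+ (f (suc j)) (fromℕ (n C j)) (fromℕ (n C suc j)))) (cong (_* f (suc j))
           (trans (sym (fromℕ-+ (n C j) (n C suc j)))
                  (cong fromℕ (nCk+nC[k+1]≡[n+1]C[k+1] n j)))))) ⟩
  fromℕ (suc n C 0) * f 0 + ∑< (suc n) (λ j → fromℕ (suc n C suc j) * f (suc j))
    ≡⟨ ∑-head (suc n) (λ j → fromℕ (suc n C j) * f j) ⟨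
  ∑< (suc (suc n)) (λ j → fromℕ (suc n C j) * f j) ∎
  where
  open ≡-Reasoning
  X Y : ℚ
  X = ∑< (suc n) (λ j → fromℕ (n C j) * f (suc j))
  Y = ∑< (suc n) (λ j → fromℕ (n C suc j) * f (suc j))
  last : fromℕ (n C suc n) * f (suc n) ≡ 0ℚ
  last = trans (cong (λ k → fromℕ k * f (suc n)) (k>n⇒nCk≡0 (ℕ.n<1+n n))) (*-zeroˡ (f (suc n)))

indicator : ∀ {P : Set} → Dec P → ℚ
indicator d = if does d then 1ℚ else 0ℚ

length-filter-∷ : ∀ {A : Set} {P : Pred A 0ℓ} (P? : Decidable P) x xs →
  fromℕ (length (filter P? (x ∷ xs))) ≡ indicator (P? x) + fromℕ (length (filter P? xs))
length-filter-∷ P? x xs with does (P? x)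
... | true  = fromℕ-+ 1 (length (filter P? xs))
... | false = sym (+-identityˡ _)

_≟V_ : ∀ {n} (v w : Vec (Fin 2) n) → Dec (v ≡ w)
_≟V_ = Vec.≡-dec Fin._≟_

-- Each `x` lies in exactly one class, that of its own key, so its indicators over all `v` add up to
-- the indicator of `P`.
classify : ∀ {A : Set} {P : Pred A 0ℓ} (P? : Decidable P) {n} (key : A → Vec (Fin 2) n) xs →
  fromℕ (length (filter P? xs)) ≡
  ∑V n (λ v → fromℕ (length (filter (λ x → P? x ×-dec (key x ≟V v)) xs)))
classify P? {n} key []       = sym (∑V-0 n)
classify P? {n} key (x ∷ xs) = begin
  fromℕ (length (filter P? (x ∷ xs)))
    ≡⟨ length-filter-∷ P? x xs ⟩
  indicator (P? x) + fromℕ (length (filter P? xs))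
    ≡⟨ cong₂ _+_ (sym one) (classify P? key xs) ⟩
  ∑V n (λ v → indicator (Q? v x)) + ∑V n (λ v → fromℕ (length (filter (Q? v) xs)))
    ≡⟨ ∑V-+ n _ _ ⟨
  ∑V n (λ v → indicator (Q? v x) + fromℕ (length (filter (Q? v) xs)))
    ≡⟨ ∑V-cong n (λ v → length-filter-∷ (Q? v) x xs) ⟨
  ∑V n (λ v → fromℕ (length (filter (Q? v) (x ∷ xs)))) ∎
  where
  open ≡-Reasoning
  Q? = λ v y → P? y ×-dec (key y ≟V v)
  one : ∑V n (λ v → indicator (Q? v x)) ≡ indicator (P? x)
  one with does (P? x)
  ... | false = ∑V-0 n
  ... | true  = ∑V-δ n _ (key x)
    (cong (if_then 1ℚ else 0ℚ) (dec-true (key x ≟V key x) refl))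
    (λ v v≢ → cong (if_then 1ℚ else 0ℚ) (dec-false (key x ≟V v) (v≢ ∘ sym)))

enumFin-size : ∀ {n} (v : Vec (Fin 2) n) i →
               proj₁ (enumFin n (Vec.lookup v) i) ≡ occurrences i v
enumFin-size []      i = refl
enumFin-size (x ∷ v) i with x Fin.≟ i
... | yes _ = cong suc (enumFin-size v i)
... | no _  = enumFin-size v i

-- The size stored in `fibre` is opaque, but `_≅_` compares carriers only, and `enumFin` enumerates
-- this carrier with a size that can be computed.
fibre-size : ∀ {n} (v : Vec (Fin 2) n) i → fibre [ n ] (Vec.lookup v) i ≅ [ occurrences i v ]
fibre-size {n} v i = subst (λ m → fibre [ n ] (Vec.lookup v) i ≅ [ m ]) (enumFin-size v i)
  (bij (proj₂ (enumFin n (Vec.lookup v) i)))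

occurrences-sum : ∀ {n} (v : Vec (Fin 2) n) →
                  occurrences (suc zero) v ≡ n ∸ occurrences zero v
occurrences-sum v = trans (sym (ℕ.m+n∸m≡n (occurrences zero v) _))
                          (cong (_∸ occurrences zero v) (total v))
  where
  total : ∀ {n} (v : Vec (Fin 2) n) → occurrences zero v ℕ.+ occurrences (suc zero) v ≡ n
  total []             = refl
  total (zero ∷ v)     = cong suc (total v)
  total (suc zero ∷ v) = trans (ℕ.+-suc (occurrences zero v) _) (cong suc (total v))

card-≅ : (F : Species) → let open Species F in
         ∀ {U V} → U ≅ V → Finite.card (finite U) ≡ Finite.card (finite V)
card-≅ F {U} {V} σ = card-≡ (finite U) (finite V) (act σ)
  (act-injective (Species.functor F) σ) (act-cong σ)
  (λ t → act (≅-sym σ) t , Setoid.trans (obj V)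
    (act-via σ (≅-sym σ) ≅-id (_≅_.strictlyInverseˡ σ) t) (act-id t))
  where open Species F

≋⇒blocks : ∀ {F G : Functor} {U} {x y : ∘-Str F G U} → _≋_ F G x y → blocks x ≡ blocks y
≋⇒blocks r = Perm.↔⇒≡ (_≅_.fun (relabel r))

2∣⇒2∤suc : ∀ {n} → 2 ∣ n → ¬ 2 ∣ suc n
2∣⇒2∤suc {n} 2∣n 2∣1+n
  with () ← ∣1⇒≡1 (∣m+n∣m⇒∣n (subst (2 ∣_) (ℕ.+-comm 1 n) 2∣1+n) 2∣n)

2∤⇒2∣suc : ∀ n → ¬ 2 ∣ n → 2 ∣ suc n
2∤⇒2∣suc zero          2∤n = contradiction (2 ∣0) 2∤n
2∤⇒2∣suc (suc zero)    2∤n = ∣-refl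
2∤⇒2∣suc (suc (suc n)) 2∤n = ∣m∣n⇒∣m+n ∣-refl (2∤⇒2∣suc n (2∤n ∘ ∣m∣n⇒∣m+n ∣-refl))

-- Recurrence from splitting off the component of a fixed point

module ComponentCounts (A B : Species) (A≅ℰ∘B : functor A ≅ˢ functor ℰ ∘ˢ functor B) where
  private
    module A = Species A
    module B = Species B
  open Counting A
  open Components A B A≅ℰ∘B

  private
    toS : ∀ U → A.Str U → ∘-Str (functor ℰ) (functor B) U
    toS U = Inverse.to (_≅ˢ_.iso A≅ℰ∘B U)

    fromS : ∀ U → ∘-Str (functor ℰ) (functor B) U → A.Str U
    fromS U = Inverse.from (_≅ˢ_.iso A≅ℰ∘B U)

    toS-cong : ∀ U {s t} → A._≈_ {U} s t → _≋_ (functor ℰ) (functor B) (toS U s) (toS U t)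
    toS-cong U = Inverse.to-cong (_≅ˢ_.iso A≅ℰ∘B U)

    toS-fromS : ∀ U x → _≋_ (functor ℰ) (functor B) (toS U (fromS U x)) x
    toS-fromS U = Inverse.strictlyInverseˡ (_≅ˢ_.iso A≅ℰ∘B U)

    toS-injective : ∀ U {s t} → _≋_ (functor ℰ) (functor B) (toS U s) (toS U t) → A._≈_ {U} s t
    toS-injective U {s} {t} r = S.trans (S.sym (Inverse.strictlyInverseʳ i s))
      (S.trans (Inverse.from-cong i r) (Inverse.strictlyInverseʳ i t))
      where
      i = _≅ˢ_.iso A≅ℰ∘B U
      module S = Setoid (A.obj U)

    ≋-sym′ : ∀ {U} {x y : ∘-Str (functor ℰ) (functor B) U} →
             _≋_ (functor ℰ) (functor B) x y → _≋_ (functor ℰ) (functor B) y x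
    ≋-sym′ = ≋-sym (functor ℰ) (functor B)

    ≋-trans′ : ∀ {U} {x y z : ∘-Str (functor ℰ) (functor B) U} →
             _≋_ (functor ℰ) (functor B) x y → _≋_ (functor ℰ) (functor B) y z →
             _≋_ (functor ℰ) (functor B) x z
    ≋-trans′ = ≋-trans (functor ℰ) (functor B)

  π₀-cong : ∀ {U s t} → A._≈_ {U} s t → π₀ {U} s ≡ π₀ {U} t
  π₀-cong {U} eq = ≋⇒blocks (toS-cong U eq)

  π₀-act : ∀ {U V} (σ : U ≅ V) s → π₀ {V} (A.act σ s) ≡ π₀ {U} s
  π₀-act σ s = ≋⇒blocks (_≅ˢ_.natural A≅ℰ∘B σ s)

  #π₀ : {R : Pred ℕ 0ℓ} → Decidable R → FinSet → ℕ
  #π₀ R? U = Finite.# (A.finite U) (λ s → R? (π₀ {U} s))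

  module _ {R : Pred ℕ 0ℓ} (R? : Decidable R) where

    π₀-finite : ∀ U → Finite (restrict (A.obj U) (λ s → R (π₀ {U} s)))
    π₀-finite U = finite-restrict (A.finite U) (λ s → R? (π₀ {U} s)) (λ eq → subst R (π₀-cong eq))

    #π₀-≅ : ∀ {U V} → U ≅ V → #π₀ R? U ≡ #π₀ R? V
    #π₀-≅ {U} {V} σ = card-≡ (π₀-finite U) (π₀-finite V)
      (λ (s , p) → A.act σ s , subst R (sym (π₀-act σ s)) p)
      (act-injective (functor A) σ) (A.act-cong σ)
      (λ (t , p) → (A.act (≅-sym σ) t , subst R (sym (π₀-act (≅-sym σ) t)) p) ,
        Setoid.trans (A.obj V)
          (A.act-via σ (≅-sym σ) ≅-id (_≅_.strictlyInverseˡ σ) t) (A.act-id t))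

    #π₀-none : ∀ U → (∀ s → ¬ R (π₀ {U} s)) → #π₀ R? U ≡ 0
    #π₀-none U ¬R = cong length (List.filter-none (λ i → R? (π₀ {U} (Inverse.from enum i)))
      (All.universal (λ i → ¬R (Inverse.from enum i)) (allFin card)))
      where open Finite (A.finite U)

    #π₀-all : ∀ U → (∀ k → R k) → #π₀ R? U ≡ Finite.card (A.finite U)
    #π₀-all U all = trans (cong length (List.filter-all (λ i → R? (π₀ {U} (Inverse.from enum i)))
      (All.universal (λ i → all _) (allFin card)))) (List.length-tabulate _)
      where open Finite (A.finite U)

    #π₀-≤ : ∀ U → #π₀ R? U ℕ.≤ Finite.card (A.finite U)
    #π₀-≤ U = ℕ.≤-trans (List.length-filter (λ i → R? (π₀ {U} (Inverse.from enum i))) (allFin card))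
      (ℕ.≤-reflexive (List.length-tabulate _))
      where open Finite (A.finite U)

  #π₀-cong : ∀ {R S : Pred ℕ 0ℓ} (R? : Decidable R) (S? : Decidable S) →
             (∀ {k} → R k → S k) → (∀ {k} → S k → R k) → ∀ U → #π₀ R? U ≡ #π₀ S? U
  #π₀-cong R? S? f g U = cong length (List.filter-≐ (λ i → R? (π₀ {U} (Inverse.from enum i)))
    (λ i → S? (π₀ {U} (Inverse.from enum i))) (f , g) (allFin card))
    where open Finite (A.finite U)

  empty : ∘-Str (functor ℰ) (functor B) [ 0 ]
  empty = record { blocks = 0 ; block = λ () ; onto = λ () ; outer = tt ; inner = λ () }

  empty-unique : (x : ∘-Str (functor ℰ) (functor B) [ 0 ]) → _≋_ (functor ℰ) (functor B) x empty
  empty-unique record { blocks = zero } = record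
    { relabel = ≅-id ; block-≡ = λ () ; outer-≈ = refl ; inner-≈ = λ () }
  empty-unique record { blocks = suc _ ; onto = onto } with () , _ ← onto zero

  π₀-empty : ∀ s → π₀ {[ 0 ]} s ≡ 0
  π₀-empty s = ≋⇒blocks (empty-unique (toS [ 0 ] s))

  π₀-nonempty : ∀ {n} s → π₀ {[ suc n ]} s ≢ 0
  π₀-nonempty {n} s eq with () ← subst Fin eq (block (toS [ suc n ] s) zero)

  #π₀-empty : ∀ {R : Pred ℕ 0ℓ} (R? : Decidable R) → R 0 → #π₀ R? [ 0 ] ≡ 1
  -- The structures of `ℰ` serve as a one-element setoid.
  #π₀-empty {R} R? R0 = card-≡ (π₀-finite R? [ 0 ]) (Species.finite ℰ [ 0 ]) _
    (λ {(s , _)} {(t , _)} _ → toS-injective [ 0 ]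
      (≋-trans′ (empty-unique (toS [ 0 ] s)) (≋-sym′ (empty-unique (toS [ 0 ] t)))))
    (λ _ → refl)
    (λ _ → (fromS [ 0 ] empty , subst R (sym (π₀-empty _)) R0) , refl)

  module Recurrence {R : Pred ℕ 0ℓ} (R? : Decidable R) (n : ℕ) where
    U = [ suc n ]

    side : ∘-Str (functor ℰ) (functor B) U → ∣ U ∣ˢ → Fin 2
    side x u with block x u Fin.≟ block x zero
    ... | yes _ = zero
    ... | no _  = suc zero

    side₀ : ∀ x u → side x u ≡ zero ⇔ block x u ≡ block x zero
    side₀ x u with block x u Fin.≟ block x zero
    ... | yes p = mk⇔ (λ _ → p) (λ _ → refl)
    ... | no ¬p = mk⇔ (λ ()) (λ p → contradiction p ¬p)

    -- Records which of the other `n` points share the block of point 0. Point 0 always does; it is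
    -- restored as the leading entry of `zero ∷ v`.
    key : A.Str U → Vec (Fin 2) n
    key s = Vec.tabulate (side (toS U s) ∘ suc)

    module _ (v : Vec (Fin 2) n) where
      open Splitting (functor B) U zero (Vec.lookup (zero ∷ v)) refl

      key⇒marked : ∀ s → key s ≡ v → Marked (toS U s)
      key⇒marked s eq zero    = mk⇔ (λ _ → refl) (λ _ → refl)
      key⇒marked s eq (suc u) = subst (λ i → i ≡ zero ⇔ _)
        (trans (sym (Vec.lookup∘tabulate (side (toS U s) ∘ suc) u)) (cong (λ w → Vec.lookup w u) eq))
        (side₀ (toS U s) (suc u))

      marked⇒key : ∀ s → Marked (toS U s) → key s ≡ v
      marked⇒key s mark = trans (Vec.tabulate-cong agree) (Vec.tabulate∘lookup v)
        where
        Fin2-≡ : ∀ (i j : Fin 2) → (i ≡ zero → j ≡ zero) → (j ≡ zero → i ≡ zero) → i ≡ j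
        Fin2-≡ zero       zero       f g = refl
        Fin2-≡ zero       (suc zero) f g = sym (f refl)
        Fin2-≡ (suc zero) zero       f g = g refl
        Fin2-≡ (suc zero) (suc zero) f g = refl
        agree : ∀ u → side (toS U s) (suc u) ≡ Vec.lookup v u
        agree u = Fin2-≡ _ _
          (λ e → Equivalence.from (mark (suc u)) (Equivalence.to (side₀ (toS U s) (suc u)) e))
          (λ e → Equivalence.from (side₀ (toS U s) (suc u)) (Equivalence.to (mark (suc u)) e))

      marked-resp : ∀ {x y} → _≋_ (functor ℰ) (functor B) x y → Marked x → Marked y
      marked-resp r mark u = mk⇔
        (λ e → trans (block-≡ r u) (trans (cong (to (relabel r)) (Equivalence.to (mark u) e))
                                          (sym (block-≡ r zero))))
        (λ e → Equivalence.from (mark u) (_≅_.injective (relabel r)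
                 (trans (sym (block-≡ r u)) (trans e (block-≡ r zero)))))

      Keyed : Pred (A.Str U) 0ℓ
      Keyed s = R (π₀ {U} s) × key s ≡ v

      keyed? : Decidable Keyed
      keyed? s = R? (π₀ {U} s) ×-dec (key s ≟V v)

      keyed-resp : Respects (A.obj U) Keyed
      keyed-resp {s} {t} eq (p , k) = subst R (π₀-cong eq) p ,
        marked⇒key t (marked-resp (toS-cong U eq) (key⇒marked s k))

      -- With the block of point 0 prescribed by `v`, `join` and `split` give a bijection. The
      -- split-off block is one component, which turns `R?` into `R? ∘ suc` on the remainder.
      #keyed-fibres : Finite.# (A.finite U) keyed? ≡
                      Finite.card (B.finite F₀) ℕ.* #π₀ (R? ∘ suc) F₁
      #keyed-fibres = sym (card-≡
        (finite-× (B.finite F₀) (π₀-finite (R? ∘ suc) F₁))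
        (finite-restrict (A.finite U) keyed? keyed-resp)
        (λ (b , t , p) → let x = join b (toS F₁ t) in
          fromS U x ,
          subst R (sym (≋⇒blocks (toS-fromS U x))) p ,
          marked⇒key _ (marked-resp (≋-sym′ (toS-fromS U x)) (join-marked b (toS F₁ t))))
        (λ {(b , t , _)} {(b′ , t′ , _)} eq →
          let x = join b (toS F₁ t)
              x′ = join b′ (toS F₁ t′)
              b≈b′ , y≋y′ = join-injective (≋-trans′ (≋-sym′ (toS-fromS U x))
                              (≋-trans′ (toS-cong U eq) (toS-fromS U x′)))
          in b≈b′ , toS-injective F₁ y≋y′)
        (λ (b≈b′ , t≈t′) → Inverse.from-cong (_≅ˢ_.iso A≅ℰ∘B U)
          (join-cong b≈b′ (toS-cong F₁ t≈t′)))
        (λ (s , p , k) →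
          let b , y , r , e = split (toS U s) (key⇒marked s k)
              r′ = toS-fromS F₁ y
          in (b , fromS F₁ y , subst R (sym (trans (cong suc (≋⇒blocks r′)) e)) p) ,
             toS-injective U (≋-trans′ (toS-fromS U _)
               (≋-trans′ (join-cong (Setoid.refl (B.obj F₀)) r′) r))))

      #keyed : Finite.# (A.finite U) keyed? ≡
               Finite.card (B.finite [ suc (occurrences zero v) ]) ℕ.*
               #π₀ (R? ∘ suc) [ n ∸ occurrences zero v ]
      #keyed = trans #keyed-fibres (cong₂ ℕ._*_
        (card-≅ B (fibre-size (zero ∷ v) zero))
        (trans (#π₀-≅ (R? ∘ suc) (fibre-size (zero ∷ v) (suc zero)))
               (cong (λ m → #π₀ (R? ∘ suc) [ m ]) (occurrences-sum v))))

    -- Here `j` counts the companions of point 0 in its block. Keeping `R` arbitrary yields the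
    -- recurrences for all structures, for the even and odd ones, and for the connected ones.
    recurrence : fromℕ (#π₀ R? [ suc n ]) ≡
      ∑< (suc n) (λ j → fromℕ (n C j) *
        (fromℕ (Finite.card (B.finite [ suc j ])) * fromℕ (#π₀ (R? ∘ suc) [ n ∸ j ])))
    recurrence = trans
      (classify (λ i → R? (π₀ {U} (Inverse.from enum i))) (key ∘ Inverse.from enum) (allFin card))
      (trans (∑V-cong n (λ v → trans (cong fromℕ (#keyed v))
                (fromℕ-* (Finite.card (B.finite [ suc (occurrences zero v) ]))
                         (#π₀ (R? ∘ suc) [ n ∸ occurrences zero v ]))))
             (∑V-binomial n (λ j → fromℕ (Finite.card (B.finite [ suc j ])) *
                                   fromℕ (#π₀ (R? ∘ suc) [ n ∸ j ]))))
      where open Finite (A.finite U)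

  open Recurrence using (recurrence)

  -- Once the block of point 0 is removed no component may remain, so only `j = n`, where that block
  -- is the whole set, contributes.
  connected-count : ∀ n → fromℕ (#π₀ (ℕ._≟ 1) [ suc n ]) ≡ fromℕ (Finite.card (B.finite [ suc n ]))
  connected-count n = begin
    fromℕ (#π₀ (ℕ._≟ 1) [ suc n ])
      ≡⟨ recurrence (ℕ._≟ 1) n ⟩
    ∑< n f + f n
      ≡⟨ cong (_+ f n) (∑-zero n vanish) ⟩
    0ℚ + fromℕ (n C n) * (c * fromℕ (#π₀ (λ k → suc k ℕ.≟ 1) [ n ∸ n ]))
      ≡⟨ cong₂ (λ x y → 0ℚ + fromℕ x * (c * fromℕ y)) (nCn≡1 n)
           (trans (cong (λ m → #π₀ (λ k → suc k ℕ.≟ 1) [ m ]) (ℕ.n∸n≡0 n))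
                  (#π₀-empty (λ k → suc k ℕ.≟ 1) refl)) ⟩
    0ℚ + 1ℚ * (c * 1ℚ)
      ≡⟨ solve 1 (λ x → con 0ℚ :+ con 1ℚ :* (x :* con 1ℚ) := x) refl c ⟩
    c ∎
    where
    open ≡-Reasoning
    c = fromℕ (Finite.card (B.finite [ suc n ]))
    f : Seq
    f j = fromℕ (n C j) *
      (fromℕ (Finite.card (B.finite [ suc j ])) * fromℕ (#π₀ (λ k → suc k ℕ.≟ 1) [ n ∸ j ]))
    vanish : ∀ j → j ℕ.< n → f j ≡ 0ℚ
    vanish j j<n = trans (cong (λ x → fromℕ (n C j) * (cⱼ * fromℕ x)) zero#)
        (solve 2 (λ x y → x :* (y :* con 0ℚ) := con 0ℚ) refl (fromℕ (n C j)) cⱼ)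
      where
      cⱼ = fromℕ (Finite.card (B.finite [ suc j ]))
      zero# : #π₀ (λ k → suc k ℕ.≟ 1) [ n ∸ j ] ≡ 0
      zero# = subst (λ m → #π₀ (λ k → suc k ℕ.≟ 1) [ m ] ≡ 0) (sym (ℕ.+-∸-assoc 1 j<n))
        (#π₀-none (λ k → suc k ℕ.≟ 1) [ suc (n ∸ suc j) ] (λ s → π₀-nonempty s ∘ ℕ.suc-injective))

-- Exponential generating functions

opaque
  -- Turns `÷₀` into multiplication by an atom for the ring solver; `opaque` hides the case
  -- distinction on a zero denominator.
  inv : ℚ → ℚ
  inv q = 1ℚ ÷₀ q

  ÷₀-inv : ∀ p q → p ÷₀ q ≡ p * inv q
  ÷₀-inv p q with q ℚ.≟ 0ℚ
  ... | yes _  = sym (*-zeroʳ p)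
  ... | no q≢0 = cong (p *_) (sym (*-identityˡ _))

  inv-inverse : ∀ {q} → q ≢ 0ℚ → q * inv q ≡ 1ℚ
  inv-inverse {q} q≢0 with q ℚ.≟ 0ℚ
  ... | yes q≡0 = contradiction q≡0 q≢0
  ... | no ≢0 = trans (cong (q *_) (*-identityˡ _)) (ℚ.*-inverseʳ q ⦃ ℚ.≢-nonZero ≢0 ⦄)

  0<inv : ∀ {q} → 0ℚ ℚ.< q → 0ℚ ℚ.< inv q
  0<inv {q} 0<q with q ℚ.≟ 0ℚ
  ... | yes q≡0 = contradiction (sym q≡0) (ℚ.<⇒≢ 0<q)
  ... | no q≢0  = subst (0ℚ ℚ.<_) (sym (*-identityˡ 1/q))
    (ℚ.positive⁻¹ 1/q ⦃ ℚ.1/pos⇒pos q ⦃ ℚ.positive 0<q ⦄ ⦄)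
    where
    1/q : ℚ
    1/q = ℚ.1/_ q ⦃ ℚ.≢-nonZero q≢0 ⦄

inv-unique : ∀ {p q} → p * q ≡ 1ℚ → q ≡ inv p
inv-unique {p} {q} pq≡1 = begin
  q                ≡⟨ *-identityʳ q ⟨
  q * 1ℚ           ≡⟨ cong (q *_) (inv-inverse p≢0) ⟨
  q * (p * inv p)  ≡⟨ solve 3 (λ x y z → x :* (y :* z) := (y :* x) :* z) refl q p (inv p) ⟩
  p * q * inv p    ≡⟨ cong (_* inv p) pq≡1 ⟩
  1ℚ * inv p       ≡⟨ *-identityˡ (inv p) ⟩
  inv p            ∎
  where
  open ≡-Reasoning
  p≢0 : p ≢ 0ℚ
  p≢0 refl with () ← trans (sym (*-zeroˡ q)) pq≡1

0<fromℕ : ∀ {n} → 1 ℕ.≤ n → 0ℚ ℚ.< fromℕ n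
0<fromℕ {n} 1≤n = ℚ.<-≤-trans (ℚ.positive⁻¹ 1ℚ) (fromℕ-mono-≤ {1} {n} 1≤n)

-- Integrality bounds nonzero coefficients `𝔡 k` away from zero, which makes `term k` comparable
-- with `scale k`.
1≤∣fromℤ∣ : ∀ z → z ≢ 0ℤ → 1ℚ ℚ.≤ ∣ fromℤ z ∣
1≤∣fromℤ∣ (ℤ.+ zero)  z≢0 = contradiction refl z≢0
1≤∣fromℤ∣ (ℤ.+ suc n) z≢0 =
  ℚ.≤-trans (fromℕ-mono-≤ {1} {suc n} (s≤s z≤n)) (p≤∣p∣ (fromℕ (suc n)))
1≤∣fromℤ∣ (ℤ.-[1+ n ]) z≢0 = ℚ.≤-trans (fromℕ-mono-≤ {1} {suc n} (s≤s z≤n))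
  (ℚ.≤-trans (p≤∣p∣ (fromℕ (suc n))) (ℚ.≤-reflexive (sym
    (trans (cong ∣_∣ (fromℤ-neg (ℤ.+ suc n))) (ℚ.∣-p∣≡∣p∣ (fromℕ (suc n)))))))

opaque
  invFact : ℕ → ℚ
  invFact n = inv (fromℕ (n !))

  ÷₀-fact : ∀ p n → p ÷₀ fromℕ (n !) ≡ p * invFact n
  ÷₀-fact p n = ÷₀-inv p (fromℕ (n !))

  fact-invFact : ∀ n → fromℕ (n !) * invFact n ≡ 1ℚ
  fact-invFact n = inv-inverse (ℚ.<⇒≢ (0<fromℕ (ℕ.1≤n! n)) ∘ sym)

  0<invFact : ∀ n → 0ℚ ℚ.< invFact n
  0<invFact n = 0<inv (0<fromℕ (ℕ.1≤n! n))

  invFact-suc : ∀ n → fromℕ (suc n) * invFact (suc n) ≡ invFact n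
  invFact-suc n = inv-unique {fromℕ (n !)} (begin
    fromℕ (n !) * (fromℕ (suc n) * invFact (suc n))
      ≡⟨ solve 3 (λ x y z → x :* (y :* z) := (y :* x) :* z) refl (fromℕ (n !)) (fromℕ (suc n)) _ ⟩
    fromℕ (suc n) * fromℕ (n !) * invFact (suc n)
      ≡⟨ cong (_* invFact (suc n)) (fromℕ-* (suc n) (n !)) ⟨
    fromℕ (suc n !) * invFact (suc n)
      ≡⟨ fact-invFact (suc n) ⟩
    1ℚ ∎)
    where open ≡-Reasoning

invFact-0 : invFact 0 ≡ 1ℚ
invFact-0 = trans (sym (*-identityˡ (invFact 0))) (fact-invFact 0)

C-fact : ∀ {n k} → k ℕ.≤ n → (n C k) ℕ.* (k ! ℕ.* (n ∸ k) !) ≡ n !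
C-fact {n} {k} k≤n = trans
  (cong (ℕ._* (k ! ℕ.* (n ∸ k) !)) (nCk≡n!/k![n-k]! k≤n))
  (ℕ.m/n*n≡m ⦃ k ℕ.!* n ∸ k !≢0 ⦄ (k![n∸k]!∣n! k≤n))

-- Converts binomial convolutions of counts into Cauchy products of exponential generating
-- sequences.
invFact-C : ∀ {n k} → k ℕ.≤ n → invFact n * fromℕ (n C k) ≡ invFact k * invFact (n ∸ k)
invFact-C {n} {k} k≤n = begin
  invFact n * c
    ≡⟨ solve 2 (λ x y → x :* y := x :* (y :* (con 1ℚ :* con 1ℚ))) refl (invFact n) c ⟩
  invFact n * (c * (1ℚ * 1ℚ))
    ≡⟨ cong₂ (λ x y → invFact n * (c * (x * y))) (fact-invFact k) (fact-invFact (n ∸ k)) ⟨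
  invFact n * (c * (fromℕ (k !) * invFact k * (fromℕ ((n ∸ k) !) * invFact (n ∸ k))))
    ≡⟨ solve 6 (λ w c p u q v → w :* (c :* (p :* u :* (q :* v))) := (c :* (p :* q)) :* w :* (u :* v))
         refl (invFact n) c (fromℕ (k !)) (invFact k) (fromℕ ((n ∸ k) !)) (invFact (n ∸ k)) ⟩
  c * (fromℕ (k !) * fromℕ ((n ∸ k) !)) * invFact n * (invFact k * invFact (n ∸ k))
    ≡⟨ cong (λ x → x * invFact n * (invFact k * invFact (n ∸ k))) (begin
         c * (fromℕ (k !) * fromℕ ((n ∸ k) !)) ≡⟨ cong (c *_) (fromℕ-* (k !) ((n ∸ k) !)) ⟨
         c * fromℕ (k ! ℕ.* (n ∸ k) !)         ≡⟨ fromℕ-* (n C k) (k ! ℕ.* (n ∸ k) !) ⟨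
         fromℕ ((n C k) ℕ.* (k ! ℕ.* (n ∸ k) !)) ≡⟨ cong fromℕ (C-fact k≤n) ⟩
         fromℕ (n !) ∎) ⟩
  fromℕ (n !) * invFact n * (invFact k * invFact (n ∸ k))
    ≡⟨ trans (cong (_* (invFact k * invFact (n ∸ k))) (fact-invFact n)) (*-identityˡ _) ⟩
  invFact k * invFact (n ∸ k) ∎
  where
  open ≡-Reasoning
  c = fromℕ (n C k)

egf : Seq → Seq
egf f n = f n * invFact n

-- F′ = C′ G for the exponential generating functions of f, c and g.
egf-derivative : ∀ (f g c : Seq) →
  (∀ n → f (suc n) ≡ ∑< (suc n) (λ j → fromℕ (n C j) * (c (suc j) * g (n ∸ j)))) →
  ∀ n → fromℕ n * egf f n ≡ ((λ k → fromℕ k * egf c k) ⋆ egf g) n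
egf-derivative f g c rec zero    =
  solve 3 (λ x y z → con 0ℚ :* x := con 0ℚ :+ con 0ℚ :* y :* z) refl
    (egf f 0) (egf c 0) (egf g 0)
egf-derivative f g c rec (suc n) = begin
  fromℕ (suc n) * (f (suc n) * invFact (suc n))
    ≡⟨ solve 3 (λ x y z → x :* (y :* z) := (x :* z) :* y) refl (fromℕ (suc n)) (f (suc n)) _ ⟩
  fromℕ (suc n) * invFact (suc n) * f (suc n)
    ≡⟨ cong₂ _*_ (invFact-suc n) (rec n) ⟩
  invFact n * ∑< (suc n) (λ j → fromℕ (n C j) * (c (suc j) * g (n ∸ j)))
    ≡⟨ ∑-*ˡ (suc n) (invFact n) _ ⟩
  ∑< (suc n) (λ j → invFact n * (fromℕ (n C j) * (c (suc j) * g (n ∸ j))))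
    ≡⟨ ∑-cong (suc n) (λ { j (s≤s j≤n) → term j j≤n }) ⟩
  ∑< (suc n) (λ j → β (suc j) * egf g (n ∸ j))
    ≡⟨ trans (cong (_+ X) (solve 2 (λ x y → con 0ℚ :* x :* y := con 0ℚ) refl (egf c 0) (egf g (suc n))))
             (+-identityˡ X) ⟨
  β 0 * egf g (suc n) + X
    ≡⟨ ∑-head (suc n) (λ k → β k * egf g (suc n ∸ k)) ⟨
  (β ⋆ egf g) (suc n) ∎
  where
  open ≡-Reasoning
  β : Seq
  β k = fromℕ k * egf c k
  X = ∑< (suc n) (λ j → β (suc j) * egf g (n ∸ j))
  term : ∀ j → j ℕ.≤ n →
         invFact n * (fromℕ (n C j) * (c (suc j) * g (n ∸ j))) ≡ β (suc j) * egf g (n ∸ j)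
  term j j≤n = begin
    invFact n * (fromℕ (n C j) * (c (suc j) * g (n ∸ j)))
      ≡⟨ *-assoc (invFact n) (fromℕ (n C j)) _ ⟨
    invFact n * fromℕ (n C j) * (c (suc j) * g (n ∸ j))
      ≡⟨ cong (_* (c (suc j) * g (n ∸ j))) (trans (invFact-C j≤n)
           (cong (_* invFact (n ∸ j)) (sym (invFact-suc j)))) ⟩
    fromℕ (suc j) * invFact (suc j) * invFact (n ∸ j) * (c (suc j) * g (n ∸ j))
      ≡⟨ solve 5 (λ x y z u v → x :* y :* z :* (u :* v) := x :* (u :* y) :* (v :* z)) refl
           (fromℕ (suc j)) (invFact (suc j)) (invFact (n ∸ j)) (c (suc j)) (g (n ∸ j)) ⟩
    β (suc j) * egf g (n ∸ j) ∎

-- From A′ = B′ A and E′ = − B′ E follows (E A)′ = 0.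
⋆-constant : ∀ (a e β : Seq) →
  (∀ n → fromℕ n * a n ≡ (β ⋆ a) n) → (∀ n → fromℕ n * e n ≡ - (β ⋆ e) n) →
  ∀ n → (e ⋆ a) (suc n) ≡ 0ℚ
⋆-constant a e β a′ e′ n = begin
  (e ⋆ a) N
    ≡⟨ *-identityˡ _ ⟨
  1ℚ * (e ⋆ a) N
    ≡⟨ cong (_* (e ⋆ a) N) (inv-inverse N≢0) ⟨
  fromℕ N * inv (fromℕ N) * (e ⋆ a) N
    ≡⟨ solve 3 (λ x y z → x :* y :* z := y :* (x :* z)) refl (fromℕ N) (inv (fromℕ N)) ((e ⋆ a) N) ⟩
  inv (fromℕ N) * (fromℕ N * (e ⋆ a) N)
    ≡⟨ cong (inv (fromℕ N) *_) scaled ⟩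
  inv (fromℕ N) * 0ℚ
    ≡⟨ *-zeroʳ (inv (fromℕ N)) ⟩
  0ℚ ∎
  where
  open ≡-Reasoning
  N = suc n
  N≢0 : fromℕ N ≢ 0ℚ
  N≢0 = ℚ.<⇒≢ (0<fromℕ {N} (s≤s z≤n)) ∘ sym
  X : ℚ
  X = ∑< (suc N) (λ k → (β ⋆ e) k * a (N ∸ k))
  leibniz : ∀ k → k ℕ.≤ N → fromℕ N * (e k * a (N ∸ k)) ≡
            - ((β ⋆ e) k * a (N ∸ k)) + e k * (β ⋆ a) (N ∸ k)
  leibniz k k≤N = begin
    fromℕ N * (e k * a (N ∸ k))
      ≡⟨ cong (λ m → fromℕ m * (e k * a (N ∸ k))) (ℕ.m+[n∸m]≡n k≤N) ⟨
    fromℕ (k ℕ.+ (N ∸ k)) * (e k * a (N ∸ k))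
      ≡⟨ cong (_* (e k * a (N ∸ k))) (fromℕ-+ k (N ∸ k)) ⟩
    (fromℕ k + fromℕ (N ∸ k)) * (e k * a (N ∸ k))
      ≡⟨ solve 4 (λ x y u v → (x :+ y) :* (u :* v) := x :* u :* v :+ u :* (y :* v)) refl
           (fromℕ k) (fromℕ (N ∸ k)) (e k) (a (N ∸ k)) ⟩
    fromℕ k * e k * a (N ∸ k) + e k * (fromℕ (N ∸ k) * a (N ∸ k))
      ≡⟨ cong₂ _+_
           (trans (cong (_* a (N ∸ k)) (e′ k)) (sym (ℚ.neg-distribˡ-* ((β ⋆ e) k) (a (N ∸ k)))))
           (cong (e k *_) (a′ (N ∸ k))) ⟩
    - ((β ⋆ e) k * a (N ∸ k)) + e k * (β ⋆ a) (N ∸ k) ∎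
  scaled : fromℕ N * (e ⋆ a) N ≡ 0ℚ
  scaled = begin
    fromℕ N * (e ⋆ a) N
      ≡⟨ ∑-*ˡ (suc N) (fromℕ N) _ ⟩
    ∑< (suc N) (λ k → fromℕ N * (e k * a (N ∸ k)))
      ≡⟨ ∑-cong (suc N) (λ { k (s≤s k≤N) → leibniz k k≤N }) ⟩
    ∑< (suc N) (λ k → - ((β ⋆ e) k * a (N ∸ k)) + e k * (β ⋆ a) (N ∸ k))
      ≡⟨ trans (∑-+ (suc N) _ _) (cong (_+ ∑< (suc N) (λ k → e k * (β ⋆ a) (N ∸ k))) (∑-neg (suc N) _)) ⟩
    - X + ∑< (suc N) (λ k → e k * (β ⋆ a) (N ∸ k))
      ≡⟨ cong (- X +_) (⋆-assoc e β a N N) ⟨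
    - X + ∑< (suc N) (λ k → (e ⋆ β) k * a (N ∸ k))
      ≡⟨ cong (- X +_) (∑-cong (suc N) (λ k _ → cong (_* a (N ∸ k)) (⋆-comm e β k))) ⟩
    - X + X
      ≡⟨ ℚ.+-inverseˡ X ⟩
    0ℚ ∎

-- From generating sequences to probabilities

module Proof (A B : Species) (A≅ℰ∘B : functor A ≅ˢ functor ℰ ∘ˢ functor B)
             (gargantuan : Counting.Gargantuan A) where
  open Counting A
  open Components A B A≅ℰ∘B
  open ComponentCounts A B A≅ℰ∘B
  open GargantuanSeq gargantuan
  open ≡-Reasoning

  a b c e β : Seq
  a n = fromℕ (𝔞 n) ÷₀ fromℕ (n !)
  -- Connected structures are counted inside `A` rather than through `B`, so that `b ≤ a` is
  -- immediate and `c n` is the numerator of `ℙ-connected n`.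
  c n = fromℕ (#π₀ (ℕ._≟ 1) [ n ])
  b   = egf c
  β n = fromℕ n * b n
  -- `- 𝔡 n` sums (-1)^π₀ over all structures on `[ n ]`, so these are the coefficients of exp (-
  -- B).
  e   = egf (λ n → - fromℤ (𝔡 n))

  a-egf : ∀ n → a n ≡ egf (fromℕ ∘ 𝔞) n
  a-egf n = ÷₀-fact (fromℕ (𝔞 n)) n

  0≤a : ∀ n → 0ℚ ℚ.≤ a n
  0≤a n = ℚ.≤-trans (*-nonNeg (0≤fromℕ (𝔞 n)) (ℚ.<⇒≤ (0<invFact n))) (ℚ.≤-reflexive (sym (a-egf n)))

  0≤b : ∀ n → 0ℚ ℚ.≤ b n
  0≤b n = *-nonNeg (0≤fromℕ (#π₀ (ℕ._≟ 1) [ n ])) (ℚ.<⇒≤ (0<invFact n))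

  b≤a : ∀ n → b n ℚ.≤ a n
  b≤a n = ℚ.≤-trans (*-monoˡ-≤ (ℚ.<⇒≤ (0<invFact n)) (fromℕ-mono-≤ (#π₀-≤ (ℕ._≟ 1) [ n ])))
                    (ℚ.≤-reflexive (sym (a-egf n)))

  open Recurrence using (recurrence)

  recurrence′ : ∀ {R : Pred ℕ 0ℓ} (R? : Decidable R) n → fromℕ (#π₀ R? [ suc n ]) ≡
    ∑< (suc n) (λ j → fromℕ (n C j) * (c (suc j) * fromℕ (#π₀ (R? ∘ suc) [ n ∸ j ])))
  recurrence′ R? n = trans (recurrence R? n) (∑-cong (suc n) (λ j _ →
    cong (λ x → fromℕ (n C j) * (x * fromℕ (#π₀ (R? ∘ suc) [ n ∸ j ]))) (sym (connected-count j))))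

  𝔞-recurrence : ∀ n → fromℕ (𝔞 (suc n)) ≡
    ∑< (suc n) (λ j → fromℕ (n C j) * (c (suc j) * fromℕ (𝔞 (n ∸ j))))
  𝔞-recurrence n = trans (cong fromℕ (sym (#π₀-all U? [ suc n ] (λ _ → tt))))
    (trans (recurrence′ U? n) (∑-cong (suc n) (λ j _ →
      cong (λ x → fromℕ (n C j) * (c (suc j) * fromℕ x)) (#π₀-all U? [ n ∸ j ] (λ _ → tt)))))

  derivative : ∀ n → fromℕ n * a n ≡ (β ⋆ a) n
  derivative n = begin
    fromℕ n * a n                       ≡⟨ cong (fromℕ n *_) (a-egf n) ⟩
    fromℕ n * egf (fromℕ ∘ 𝔞) n         ≡⟨ egf-derivative (fromℕ ∘ 𝔞) (fromℕ ∘ 𝔞) c 𝔞-recurrence n ⟩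
    (β ⋆ egf (fromℕ ∘ 𝔞)) n             ≡⟨ ∑-cong (suc n) (λ k _ → cong (β k *_) (a-egf (n ∸ k))) ⟨
    (β ⋆ a) n ∎

  evens odds : ℕ → ℕ
  evens n = #π₀ (2 ∣?_) [ n ]
  odds  n = #π₀ (¬? ∘ (2 ∣?_)) [ n ]

  𝔡-difference : ∀ n → fromℤ (𝔡 n) ≡ fromℕ (odds n) - fromℕ (evens n)
  𝔡-difference n = trans (fromℤ-+ (ℤ.+ odds n) (ℤ.- (ℤ.+ evens n)))
    (cong (fromℕ (odds n) +_) (fromℤ-neg (ℤ.+ evens n)))

  -- Removing one component flips the parity of `π₀`; together with `odds-suc` this produces the
  -- minus sign in E′ = - B′ E.
  evens-suc : ∀ n → #π₀ ((2 ∣?_) ∘ suc) [ n ] ≡ odds n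
  evens-suc n = #π₀-cong ((2 ∣?_) ∘ suc) (¬? ∘ (2 ∣?_)) (λ p q → 2∣⇒2∤suc q p) (λ {k} → 2∤⇒2∣suc k) [ n ]

  odds-suc : ∀ n → #π₀ (¬? ∘ (2 ∣?_) ∘ suc) [ n ] ≡ evens n
  odds-suc n = #π₀-cong (¬? ∘ (2 ∣?_) ∘ suc) (2 ∣?_)
    (λ {k} p → decidable-stable (2 ∣? k) (p ∘ 2∤⇒2∣suc k)) 2∣⇒2∤suc [ n ]

  𝔡-recurrence : ∀ n → - fromℤ (𝔡 (suc n)) ≡
    ∑< (suc n) (λ j → fromℕ (n C j) * (c (suc j) * fromℤ (𝔡 (n ∸ j))))
  𝔡-recurrence n = begin
    - fromℤ (𝔡 (suc n))
      ≡⟨ cong -_ (𝔡-difference (suc n)) ⟩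
    - (fromℕ (odds (suc n)) - fromℕ (evens (suc n)))
      ≡⟨ solve 2 (λ x y → :- (x :- y) := y :+ :- x) refl (fromℕ (odds (suc n))) (fromℕ (evens (suc n))) ⟩
    fromℕ (evens (suc n)) + - fromℕ (odds (suc n))
      ≡⟨ cong₂ (λ x y → x + - y) (recurrence′ (2 ∣?_) n) (recurrence′ (¬? ∘ (2 ∣?_)) n) ⟩
    ∑< (suc n) f + - ∑< (suc n) g
      ≡⟨ cong (∑< (suc n) f +_) (∑-neg (suc n) g) ⟨
    ∑< (suc n) f + ∑< (suc n) (λ j → - g j)
      ≡⟨ ∑-+ (suc n) f (λ j → - g j) ⟨
    ∑< (suc n) (λ j → f j + - g j)
      ≡⟨ ∑-cong (suc n) (λ j _ → difference j) ⟩
    ∑< (suc n) (λ j → fromℕ (n C j) * (c (suc j) * fromℤ (𝔡 (n ∸ j)))) ∎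
    where
    f g : Seq
    f j = fromℕ (n C j) * (c (suc j) * fromℕ (#π₀ ((2 ∣?_) ∘ suc) [ n ∸ j ]))
    g j = fromℕ (n C j) * (c (suc j) * fromℕ (#π₀ (¬? ∘ (2 ∣?_) ∘ suc) [ n ∸ j ]))
    difference : ∀ j → f j + - g j ≡ fromℕ (n C j) * (c (suc j) * fromℤ (𝔡 (n ∸ j)))
    difference j = begin
      f j + - g j
        ≡⟨ cong₂ (λ x y → fromℕ (n C j) * (c (suc j) * fromℕ x) + - (fromℕ (n C j) * (c (suc j) * fromℕ y)))
             (evens-suc (n ∸ j)) (odds-suc (n ∸ j)) ⟩
      fromℕ (n C j) * (c (suc j) * fromℕ (odds (n ∸ j))) +
        - (fromℕ (n C j) * (c (suc j) * fromℕ (evens (n ∸ j))))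
        ≡⟨ solve 4 (λ x y u v → x :* (y :* u) :+ :- (x :* (y :* v)) := x :* (y :* (u :- v))) refl
             (fromℕ (n C j)) (c (suc j)) (fromℕ (odds (n ∸ j))) (fromℕ (evens (n ∸ j))) ⟩
      fromℕ (n C j) * (c (suc j) * (fromℕ (odds (n ∸ j)) - fromℕ (evens (n ∸ j))))
        ≡⟨ cong (λ x → fromℕ (n C j) * (c (suc j) * x)) (𝔡-difference (n ∸ j)) ⟨
      fromℕ (n C j) * (c (suc j) * fromℤ (𝔡 (n ∸ j))) ∎

  e-derivative : ∀ n → fromℕ n * e n ≡ - (β ⋆ e) n
  e-derivative n = begin
    fromℕ n * e n
      ≡⟨ egf-derivative (λ n → - fromℤ (𝔡 n)) (fromℤ ∘ 𝔡) c 𝔡-recurrence n ⟩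
    (β ⋆ egf (fromℤ ∘ 𝔡)) n
      ≡⟨ ∑-cong (suc n) (λ k _ → solve 3 (λ x y z → x :* (y :* z) := :- (x :* ((:- y) :* z))) refl
           (β k) (fromℤ (𝔡 (n ∸ k))) (invFact (n ∸ k))) ⟩
    ∑< (suc n) (λ k → - (β k * e (n ∸ k)))
      ≡⟨ ∑-neg (suc n) _ ⟩
    - (β ⋆ e) n ∎

  -- The only structure on the empty set has 0 components, an even number. Hence the leading term 1
  -- also has the form `- 𝔡 k * scale k`, with `k = 0`.
  𝔡₀ : fromℤ (𝔡 0) ≡ - 1ℚ
  𝔡₀ = trans (𝔡-difference 0) (cong₂ (λ x y → fromℕ x - fromℕ y)
    (#π₀-none (¬? ∘ (2 ∣?_)) [ 0 ] (λ s 2∤ → 2∤ (subst (2 ∣_) (sym (π₀-empty s)) (2 ∣0))))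
    (#π₀-empty (2 ∣?_) (2 ∣0)))

  e₀ : e 0 ≡ 1ℚ
  e₀ = cong₂ (λ x y → - x * y) 𝔡₀ invFact-0

  a₀ : a 0 ≡ 1ℚ
  a₀ = cong (λ x → fromℕ x ÷₀ 1ℚ)
    (trans (sym (#π₀-all U? [ 0 ] (λ _ → tt))) (#π₀-empty U? tt))

  open Bender a b e 0≤a 0≤b b≤a derivative
    (cong₂ (λ x y → 0ℚ + x * y) e₀ a₀)
    (⋆-constant a e β derivative e-derivative)
    products
    using (expansion)

  inv-𝔞 : ∀ {n} → a n ≢ 0ℚ → inv (fromℕ (𝔞 n)) ≡ inv (a n) * invFact n
  inv-𝔞 {n} aₙ≢0 = sym (inv-unique (begin
    fromℕ (𝔞 n) * (inv (a n) * invFact n)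
      ≡⟨ solve 3 (λ x y z → x :* (y :* z) := x :* z :* y) refl (fromℕ (𝔞 n)) (inv (a n)) (invFact n) ⟩
    egf (fromℕ ∘ 𝔞) n * inv (a n)
      ≡⟨ cong (_* inv (a n)) (a-egf n) ⟨
    a n * inv (a n)
      ≡⟨ inv-inverse aₙ≢0 ⟩
    1ℚ ∎))

  ratio-egf : ∀ (f : Seq) {n k} → a n ≢ 0ℚ → k ℕ.≤ n →
    fromℕ (n C k) * (f (n ∸ k) ÷₀ fromℕ (𝔞 n)) ≡ invFact k * (egf f (n ∸ k) * inv (a n))
  ratio-egf f {n} {k} aₙ≢0 k≤n = begin
    binom * (f m ÷₀ fromℕ (𝔞 n))
      ≡⟨ cong (binom *_) (÷₀-inv (f m) (fromℕ (𝔞 n))) ⟩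
    binom * (f m * inv (fromℕ (𝔞 n)))
      ≡⟨ cong (λ x → binom * (f m * x)) (inv-𝔞 aₙ≢0) ⟩
    binom * (f m * (inv (a n) * invFact n))
      ≡⟨ solve 4 (λ c x y z → c :* (x :* (y :* z)) := (z :* c) :* (x :* y)) refl
           binom (f m) (inv (a n)) (invFact n) ⟩
    invFact n * binom * (f m * inv (a n))
      ≡⟨ cong (_* (f m * inv (a n))) (invFact-C k≤n) ⟩
    invFact k * invFact m * (f m * inv (a n))
      ≡⟨ solve 4 (λ x y z w → x :* y :* (z :* w) := x :* (z :* y :* w)) refl
           (invFact k) (invFact m) (f m) (inv (a n)) ⟩
    invFact k * (egf f m * inv (a n)) ∎
    where
    m = n ∸ k
    binom = fromℕ (n C k)

  -- Up to the constant factor 1 / k!, the scale is `a (n ∸ k)` divided by `a n`; bounds on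
  -- sequences thus become bounds along `scale` after division by `a n`.
  scale-a : ∀ {n} k → a n ≢ 0ℚ → k ℕ.≤ n → scale k n ≡ invFact k * (a (n ∸ k) * inv (a n))
  scale-a {n} zero aₙ≢0 k≤n = sym (cong₂ _*_ invFact-0 (inv-inverse aₙ≢0))
  scale-a {n} k@(suc _) aₙ≢0 k≤n = trans (ratio-egf (fromℕ ∘ 𝔞) aₙ≢0 k≤n)
    (cong (λ x → invFact k * (x * inv (a n))) (sym (a-egf (n ∸ k))))

  term-scale : ∀ k n → term k n ≡ - fromℤ (𝔡 k) * scale k n
  term-scale zero    n = cong (λ x → - x * 1ℚ) (sym 𝔡₀)
  term-scale (suc k) n = solve 3 (λ x y z → :- (x :* y :* z) := (:- x) :* (y :* z)) refl
    (fromℤ (𝔡 (suc k))) (fromℕ (n C suc k)) (fromℕ (𝔞 (n ∸ suc k)) ÷₀ fromℕ (𝔞 n))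

  term-a : ∀ {n} k → a n ≢ 0ℚ → k ℕ.≤ n → term k n ≡ e k * a (n ∸ k) * inv (a n)
  term-a {n} k aₙ≢0 k≤n = trans (term-scale k n) (trans (cong (- fromℤ (𝔡 k) *_) (scale-a k aₙ≢0 k≤n))
    (solve 4 (λ x y z w → x :* (y :* (z :* w)) := x :* y :* z :* w) refl
      (- fromℤ (𝔡 k)) (invFact k) (a (n ∸ k)) (inv (a n))))

  ℙ-b : ∀ {n} → a n ≢ 0ℚ → ℙ-connected n ≡ b n * inv (a n)
  ℙ-b {n} aₙ≢0 = begin
    c n ÷₀ fromℕ (𝔞 n)              ≡⟨ ÷₀-inv (c n) (fromℕ (𝔞 n)) ⟩
    c n * inv (fromℕ (𝔞 n))         ≡⟨ cong (c n *_) (inv-𝔞 aₙ≢0) ⟩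
    c n * (inv (a n) * invFact n)
      ≡⟨ solve 3 (λ x y z → x :* (y :* z) := x :* z :* y) refl (c n) (inv (a n)) (invFact n) ⟩
    b n * inv (a n)                 ∎

  eventually-≥ : ∀ k → Eventually (k ℕ.≤_)
  eventually-≥ k = k , λ n k≤n → k≤n

  ∣scale∣ : ∀ {n} k → a n ≢ 0ℚ → k ℕ.≤ n →
            ∣ scale k n ∣ ≡ invFact k * (∣ a (n ∸ k) ∣ * ∣ inv (a n) ∣)
  ∣scale∣ {n} k aₙ≢0 k≤n = trans (cong ∣_∣ (scale-a k aₙ≢0 k≤n))
    (trans (ℚ.∣p*q∣≡∣p∣*∣q∣ (invFact k) (a (n ∸ k) * inv (a n)))
      (cong₂ _*_ (ℚ.0≤p⇒∣p∣≡p (ℚ.<⇒≤ (0<invFact k))) (ℚ.∣p*q∣≡∣p∣*∣q∣ (a (n ∸ k)) (inv (a n)))))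

  ∣a∣-scale : ∀ {n} k K → a n ≢ 0ℚ → k ℕ.≤ n →
              K * ∣ a (n ∸ k) ∣ * ∣ inv (a n) ∣ ≡ K * fromℕ (k !) * ∣ scale k n ∣
  ∣a∣-scale {n} k K aₙ≢0 k≤n = begin
    K * x * i
      ≡⟨ *-identityˡ (K * x * i) ⟨
    1ℚ * (K * x * i)
      ≡⟨ cong (_* (K * x * i)) (fact-invFact k) ⟨
    fromℕ (k !) * invFact k * (K * x * i)
      ≡⟨ solve 5 (λ f w k x i → f :* w :* (k :* x :* i) := k :* f :* (w :* (x :* i))) refl
           (fromℕ (k !)) (invFact k) K x i ⟩
    K * fromℕ (k !) * (invFact k * (x * i))
      ≡⟨ cong (K * fromℕ (k !) *_) (∣scale∣ k aₙ≢0 k≤n) ⟨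
    K * fromℕ (k !) * ∣ scale k n ∣ ∎
    where
    x i : ℚ
    x = ∣ a (n ∸ k) ∣
    i = ∣ inv (a n) ∣

  truncated : ℕ → Seq
  truncated r n = b n - ∑< (suc r) (λ k → e k * a (n ∸ k))

  ℙ-truncated : ∀ {n} r → a n ≢ 0ℚ → r ℕ.≤ n →
    ℙ-connected n - ∑< (suc r) (λ k → term k n) ≡ truncated r n * inv (a n)
  ℙ-truncated {n} r aₙ≢0 r≤n = begin
    ℙ-connected n - ∑< (suc r) (λ k → term k n)
      ≡⟨ cong₂ _-_ (ℙ-b aₙ≢0)
           (trans (∑-cong (suc r) (λ { k (s≤s k≤r) → term-a k aₙ≢0 (ℕ.≤-trans k≤r r≤n) }))
                  (sym (∑-*ʳ (suc r) i (λ k → e k * a (n ∸ k))))) ⟩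
    b n * i - S * i
      ≡⟨ solve 3 (λ x y z → x :* z :- y :* z := (x :- y) :* z) refl (b n) S i ⟩
    (b n - S) * i ∎
    where
    i S : ℚ
    i = inv (a n)
    S = ∑< (suc r) (λ k → e k * a (n ∸ k))

  remainder : ∀ r → (λ n → ℙ-connected n - ∑[ 0 ⋯ r ] λ k → term k n) =O scale (suc r)
  -- The factorial compensates the factor `invFact (suc r)` contained in `scale (suc r)`.
  remainder r = K * fromℕ (suc r !) , eventually-map step
      (eventually-× nonzero (eventually-× (eventually-≥ (suc r)) (proj₂ (expansion r))))
    where
    K : ℚ
    K = proj₁ (expansion r)
    step : ∀ n → a n ≢ 0ℚ × suc r ℕ.≤ n × ∣ truncated r n ∣ ℚ.≤ K * ∣ a (n ∸ suc r) ∣ →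
           ∣ ℙ-connected n - ∑< (suc r) (λ k → term k n) ∣ ℚ.≤ K * fromℕ (suc r !) * ∣ scale (suc r) n ∣
    step n (aₙ≢0 , r<n , le) = ℚ.≤-trans
      (ℚ.≤-reflexive (trans (cong ∣_∣ (ℙ-truncated r aₙ≢0 (ℕ.<⇒≤ r<n)))
                            (ℚ.∣p*q∣≡∣p∣*∣q∣ (truncated r n) (inv (a n)))))
      (ℚ.≤-trans (*-monoˡ-≤ (ℚ.0≤∣p∣ (inv (a n))) le)
                 (ℚ.≤-reflexive (∣a∣-scale (suc r) K aₙ≢0 r<n)))

  invFact-≤ : ∀ k → invFact (suc k) ℚ.≤ invFact k
  invFact-≤ k = ℚ.≤-trans (ℚ.≤-reflexive (sym (*-identityˡ _)))
    (ℚ.≤-trans (*-monoˡ-≤ (ℚ.<⇒≤ (0<invFact (suc k))) (fromℕ-mono-≤ {1} {suc k} (s≤s z≤n)))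
               (ℚ.≤-reflexive (invFact-suc k)))

  a-shift : ∀ ε → 0ℚ ℚ.< ε → Eventually λ n → ∣ a (n ∸ 1) ∣ ℚ.≤ ε * ∣ a n ∣
  a-shift ε 0<ε = eventually-map step (eventually-× nonzero (ratio ε 0<ε))
    where
    step : ∀ n → a n ≢ 0ℚ × ∣ a (n ∸ 1) ÷₀ a n ∣ ℚ.< ε → ∣ a (n ∸ 1) ∣ ℚ.≤ ε * ∣ a n ∣
    step n (aₙ≢0 , lt) = ℚ.≤-trans (ℚ.≤-reflexive eq) (*-monoˡ-≤ (ℚ.0≤∣p∣ (a n)) (ℚ.<⇒≤ lt))
      where
      x = a (n ∸ 1)
      eq : ∣ x ∣ ≡ ∣ x ÷₀ a n ∣ * ∣ a n ∣
      eq = begin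
        ∣ x ∣                    ≡⟨ cong ∣_∣ (trans (cong (x *_) (inv-inverse aₙ≢0)) (*-identityʳ x)) ⟨
        ∣ x * (a n * inv (a n)) ∣
          ≡⟨ cong ∣_∣ (solve 3 (λ x y z → x :* (y :* z) := x :* z :* y) refl x (a n) (inv (a n))) ⟩
        ∣ x * inv (a n) * a n ∣  ≡⟨ cong (λ y → ∣ y * a n ∣) (÷₀-inv x (a n)) ⟨
        ∣ (x ÷₀ a n) * a n ∣     ≡⟨ ℚ.∣p*q∣≡∣p∣*∣q∣ (x ÷₀ a n) (a n) ⟩
        ∣ x ÷₀ a n ∣ * ∣ a n ∣   ∎

  -- Condition (i) at index `n ∸ k` compares consecutive values of `a`; the constants 1 / k!
  -- decrease in `k` and preserve the bound.
  scale-o : ∀ k → scale (suc k) =o scale k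
  scale-o k ε 0<ε = eventually-map step
      (eventually-× nonzero (eventually-× (eventually-≥ (suc k)) (eventually-shift k (a-shift ε 0<ε))))
    where
    step : ∀ n → a n ≢ 0ℚ × suc k ℕ.≤ n × ∣ a (n ∸ k ∸ 1) ∣ ℚ.≤ ε * ∣ a (n ∸ k) ∣ →
           ∣ scale (suc k) n ∣ ℚ.≤ ε * ∣ scale k n ∣
    step n (aₙ≢0 , k<n , le) = subst₂ ℚ._≤_ (sym (∣scale∣ (suc k) aₙ≢0 k<n))
        (trans (solve 4 (λ w ε x i → w :* (ε :* x :* i) := ε :* (w :* (x :* i))) refl
                 (invFact k) ε (∣ a (n ∸ k) ∣) (∣ i ∣))
               (cong (ε *_) (sym (∣scale∣ k aₙ≢0 (ℕ.<⇒≤ k<n)))))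
        (ℚ.≤-trans (*-monoˡ-≤ (*-nonNeg (ℚ.0≤∣p∣ (a (n ∸ suc k))) (ℚ.0≤∣p∣ i)) (invFact-≤ k))
          (*-monoʳ-≤ (ℚ.<⇒≤ (0<invFact k)) (*-monoˡ-≤ (ℚ.0≤∣p∣ i)
            (subst (λ m → ∣ a m ∣ ℚ.≤ ε * ∣ a (n ∸ k) ∣)
                   (trans (ℕ.∸-+-assoc n k 1) (cong (n ∸_) (ℕ.+-comm k 1))) le))))
      where
      i = inv (a n)

  module _ (𝔡≢0 : ∀ k → 1 ≤ k → 𝔡 k ≢ 0ℤ) where

    ∣𝔡∣ : ℕ → ℚ
    ∣𝔡∣ k = ∣ fromℤ (𝔡 k) ∣

    1≤∣𝔡∣ : ∀ k → 1ℚ ℚ.≤ ∣𝔡∣ k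
    1≤∣𝔡∣ zero    = ℚ.≤-reflexive (cong ∣_∣ (sym 𝔡₀))
    1≤∣𝔡∣ (suc k) = 1≤∣fromℤ∣ (𝔡 (suc k)) (𝔡≢0 (suc k) (s≤s z≤n))

    ∣term∣ : ∀ k n → ∣ term k n ∣ ≡ ∣𝔡∣ k * ∣ scale k n ∣
    ∣term∣ k n = trans (cong ∣_∣ (term-scale k n)) (trans (ℚ.∣p*q∣≡∣p∣*∣q∣ (- fromℤ (𝔡 k)) (scale k n))
      (cong (_* ∣ scale k n ∣) (ℚ.∣-p∣≡∣p∣ (fromℤ (𝔡 k)))))

    -- Allows an error measured along `scale` to be restated along `term`, as the literal expansion
    -- demands.
    scale≤term : ∀ k n → ∣ scale k n ∣ ℚ.≤ ∣ term k n ∣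
    scale≤term k n = ℚ.≤-trans (ℚ.≤-reflexive (sym (*-identityˡ _)))
      (ℚ.≤-trans (*-monoˡ-≤ (ℚ.0≤∣p∣ (scale k n)) (1≤∣𝔡∣ k)) (ℚ.≤-reflexive (sym (∣term∣ k n))))

    term-o : ∀ k → term (suc k) =o term k
    -- Dividing `ε` by `∣𝔡∣ (suc k)` in advance offsets the factor by which `term (suc k)` exceeds
    -- `scale (suc k)`.
    term-o k ε 0<ε = eventually-map step (scale-o k (ε * inv d) 0<ε′)
      where
      d = ∣𝔡∣ (suc k)
      0<d : 0ℚ ℚ.< d
      0<d = ℚ.<-≤-trans (ℚ.positive⁻¹ 1ℚ) (1≤∣𝔡∣ (suc k))
      0<ε′ : 0ℚ ℚ.< ε * inv d
      0<ε′ = ℚ.≤-<-trans (ℚ.≤-reflexive (sym (*-zeroˡ (inv d))))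
        (ℚ.*-monoˡ-<-pos (inv d) ⦃ ℚ.positive (0<inv 0<d) ⦄ 0<ε)
      step : ∀ n → ∣ scale (suc k) n ∣ ℚ.≤ ε * inv d * ∣ scale k n ∣ →
             ∣ term (suc k) n ∣ ℚ.≤ ε * ∣ term k n ∣
      step n le = ℚ.≤-trans (ℚ.≤-reflexive (∣term∣ (suc k) n))
        (ℚ.≤-trans (*-monoʳ-≤ (ℚ.<⇒≤ 0<d) le)
        (ℚ.≤-trans (ℚ.≤-reflexive (begin
            d * (ε * inv d * ∣ scale k n ∣)
              ≡⟨ solve 4 (λ d ε i x → d :* (ε :* i :* x) := (d :* i) :* (ε :* x)) refl
                   d ε (inv d) (∣ scale k n ∣) ⟩
            d * inv d * (ε * ∣ scale k n ∣)
              ≡⟨ cong (_* (ε * ∣ scale k n ∣)) (inv-inverse (ℚ.<⇒≢ 0<d ∘ sym)) ⟩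
            1ℚ * (ε * ∣ scale k n ∣)
              ≡⟨ *-identityˡ _ ⟩
            ε * ∣ scale k n ∣ ∎))
          (*-monoʳ-≤ (ℚ.<⇒≤ 0<ε) (scale≤term k n))))

    term-expansion : ℙ-connected ≈∑ term
    term-expansion = record
      { remainder = λ r → O-boundʳ (remainder r) (always (scale≤term (suc r)))
      ; scale     = term-o
      }

proposition3p6 : (A B : Species) →
    ¬ Species.Str B [ 0 ] →
    (A≅ℰ∘B : functor A ≅ˢ functor ℰ ∘ˢ functor B) →
    Counting.Gargantuan A →
    let open Components A B A≅ℰ∘B in
    Expansion ℙ-connected term scale
    × ((∀ k → 1 ≤ k → 𝔡 k ≢ 0ℤ) → ℙ-connected ≈∑ term)
proposition3p6 A B _ A≅ℰ∘B gargantuan =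
  record { remainder = P.remainder ; scale = P.scale-o } , P.term-expansion
  where module P = Proof A B A≅ℰ∘B gargantuan
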